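{- For every matroid on a ground set $E$ with $|E|\le 11$, the uniform probability measure on its independent sets (regarded as a measure on $\{0,1\}^E$ via indicator vectors) has the conditional antipodal pairs property (CAPP).
   Context: For $\nu$ a probability measure on $\{0,1\}^S$ with $|S|=m$, write $|\eta|=\sum\eta_i$, $\mathbf{1}=(1,\dots,1)$, and $\gamma_i(\nu)=\binom{m}{i}^{ -1}\sum\{\nu(\eta)\nu(\mathbf{1}-\eta):\eta\in\{0,1\}^S,|\eta|=i\}$. If $|S|=2k$, $\nu$ has the antipodal pairs property (APP) if $\gamma_k(\nu)\ge\gamma_{k-1}(\nu)$. Conditioning a measure $\mu$ on $\{0,1\}^E$ means passing to $\mu(\cdot\mid\eta_i=\xi_i\ \forall i\in I)$ for some $I\subseteq E$, $\xi\in\{0,1\}^I$ with positive probability, regarded as a measure on $\{0,1\}^{E\setminus I}$. $\mu$ has the CAPP if every measure obtained from it by conditioning on the values of $|E|-2k$ coordinates (for some $k$) has the APP. -}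

module Defs where

open import Data.Bool using (Bool; true; false; not; if_then_else_; T)
open import Data.Nat using (ℕ; zero; suc; _<_)
open import Data.Nat.Combinatorics using (_C_)
open import Data.Fin using (Fin)
open import Data.Vec using (Vec; []; _∷_; lookup; _[_]≔_)
open import Data.Maybe using (Maybe; just; nothing)
open import Data.List using (List; []; _∷_; map; _++_; filter; length)
open import Data.Integer using (+_)
open import Data.Rational using (ℚ; 0ℚ; _*_; _+_; _÷_; _/_)
import Data.Rational as ℚ
open import Data.Rational.Properties using (_≟_)
open import Data.Product using (Σ; _×_; ∃-syntax)
open import Relation.Nullary using (yes; no; ¬_)

-- Configurations {0,1}^E with E = Fin n, as Vec Bool n.
-- A configuration is identified with the subset of E it indicates.

Config : ℕ → Set
Config n = Vec Bool n

allConfigs : (n : ℕ) → List (Config n)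
allConfigs zero    = [] ∷ []
allConfigs (suc n) = map (false ∷_) (allConfigs n) ++ map (true ∷_) (allConfigs n)

∣_∣ : ∀ {n} → Config n → ℕ
∣ [] ∣          = 0
∣ true ∷ xs ∣   = suc ∣ xs ∣
∣ false ∷ xs ∣  = ∣ xs ∣

_⊆_ : ∀ {n} → Config n → Config n → Set
η ⊆ ζ = ∀ i → T (lookup η i) → T (lookup ζ i)

emptySet : ∀ n → Config n
emptySet zero    = []
emptySet (suc n) = false ∷ emptySet n

record Matroid (n : ℕ) : Set where
  field
    indep     : Config n → Bool
    indep-∅   : T (indep (emptySet n))
    indep-⊆   : ∀ I J → I ⊆ J → T (indep J) → T (indep I)
    augment   : ∀ I J → T (indep I) → T (indep J) → ∣ I ∣ < ∣ J ∣ →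
                ∃[ e ] (T (not (lookup I e)) × T (lookup J e)
                        × T (indep (I [ e ]≔ true)))

Measure : ℕ → Set
Measure n = Config n → ℚ

sumℚ : List ℚ → ℚ
sumℚ []       = 0ℚ
sumℚ (x ∷ xs) = x + sumℚ xs

-- total division (q / 0 := 0); only used with nonzero denominators
_ℚ/_ : ℚ → ℚ → ℚ
p ℚ/ q with q ≟ 0ℚ
... | yes _ = 0ℚ
... | no q≢0 = _÷_ p q {{ℚ.≢-nonZero q≢0}}

natℚ : ℕ → ℚ
natℚ k = (+ k) / 1

uniformIndep : ∀ {n} → Matroid n → Measure n
uniformIndep {n} M η =
  if Matroid.indep M η
  then 1ℚ' ℚ/ natℚ (length (filter (λ ζ → Matroid.indep M ζ ≟b true) (allConfigs n)))
  else 0ℚ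
  where
  open import Data.Bool.Properties renaming (_≟_ to _≟b_)
  1ℚ' = ℚ.1ℚ

-- Conditioning.  A partial assignment ρ : Vec (Maybe Bool) n encodes
-- I = {i | ρ i = just _} and ξ_i for i ∈ I.  The conditioned measure
-- lives on {0,1}^(E∖I); a configuration of E∖I is represented by the
-- unique configuration of E that agrees with ξ on I.

Partial : ℕ → Set
Partial n = Vec (Maybe Bool) n

agrees : ∀ {n} → Partial n → Config n → Bool
agrees []             []       = true
agrees (nothing ∷ ρ)  (_ ∷ η)  = agrees ρ η
agrees (just b ∷ ρ)   (x ∷ η)  = if b then (if x then agrees ρ η else false)
                                        else (if x then false else agrees ρ η)

freeCount : ∀ {n} → Partial n → ℕ
freeCount []            = 0
freeCount (nothing ∷ ρ) = suc (freeCount ρ)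
freeCount (just _ ∷ ρ)  = freeCount ρ

freeWeight : ∀ {n} → Partial n → Config n → ℕ
freeWeight []            []       = 0
freeWeight (nothing ∷ ρ) (x ∷ η)  = if x then suc (freeWeight ρ η) else freeWeight ρ η
freeWeight (just _ ∷ ρ)  (_ ∷ η)  = freeWeight ρ η

flipFree : ∀ {n} → Partial n → Config n → Config n
flipFree []            []       = []
flipFree (nothing ∷ ρ) (x ∷ η)  = not x ∷ flipFree ρ η
flipFree (just _ ∷ ρ)  (x ∷ η)  = x ∷ flipFree ρ η

freeConfigs : ∀ {n} → Partial n → List (Config n)
freeConfigs {n} ρ = filter (λ η → agrees ρ η ≟b true) (allConfigs n)
  where open import Data.Bool.Properties renaming (_≟_ to _≟b_)

condProb : ∀ {n} → Measure n → Partial n → ℚ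
condProb μ ρ = sumℚ (map μ (freeConfigs ρ))

condition : ∀ {n} → Measure n → Partial n → Measure n
condition μ ρ η = μ η ℚ/ condProb μ ρ

γ : ∀ {n} → Partial n → Measure n → ℕ → ℚ
γ ρ ν i =
  sumℚ (map (λ η → ν η * ν (flipFree ρ η))
            (filter (λ η → freeWeight ρ η ℕ≟ i) (freeConfigs ρ)))
  ℚ/ natℚ (freeCount ρ C i)
  where open import Data.Nat using () renaming (_≟_ to _ℕ≟_)

-- APP for a measure on {0,1}^S with |S| = 2k  (k ≥ 1): γ_k ≥ γ_{k-1}
APP : ∀ {n} → Partial n → Measure n → (k : ℕ) → Set
APP ρ ν k = γ ρ ν (Data.Nat.pred k) ℚ.≤ γ ρ ν k
  where import Data.Nat

CAPP : ∀ {n} → Measure n → Set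
CAPP μ = ∀ (ρ : Partial _) (k : ℕ) → 1 Data.Nat.≤ k → freeCount ρ ≡ 2 Data.Nat.* k →
         0ℚ ℚ.< condProb μ ρ → APP ρ (condition μ ρ) k
  where import Data.Nat
        open import Relation.Binary.PropositionalEquality using (_≡_)

{-# OPTIONS --safe #-}
-- Let m = 2k be the number of free coordinates. Conditioning passes to a minor, so if N_i counts the pairs of
-- complementary independent sets (η, 1-η) of the minor with |η| = i, the claim is (k+1) N_(k-1) ≤ k N_k.
-- For q ≥ 1 the polynomial f(s,x) = Σ_X q^r(X) x^X s^(m-|X|), r the rank function, is Lorentzian, hence so is
-- f(s,x) f(t,y), and applying all the operators ∂/∂x_e + ∂/∂y_e leaves Σ_i Z_i s^(m-i) t^i, where Z_i sums
-- q^(r(η)+r(1-η)) over |η| = i. Its coefficients are therefore ultra log-concave; as Z_(k-1) = Z_(k+1), this gives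
-- (k+1) Z_(k-1) ≤ k Z_k, and letting q → ∞ isolates the pairs counted by N_i.
-- The Lorentzian property is proved for Hessians, adding the operators one at a time: if A and B are Hessians of
-- ∂/∂x_e and ∂/∂y_e of the same cubic, then A(y_e,·) = B(x_e,·), both diagonal entries A(y_e,y_e) and B(x_e,x_e)
-- vanish, and A and B are nonpositive on the kernel of this functional unless it is zero; positivity of all the
-- weights q^r(X) excludes the zero case except when A or B is zero.
module Submission where

open import Defs
open import Data.Nat using (ℕ; zero; suc; _∸_; _!; _^_; z≤n; s≤s)
import Data.Nat as ℕ
import Data.Nat.Properties as ℕₚ
import Data.Nat.Tactic.RingSolver as ℕ-Solver
open import Data.Nat.Combinatorics using (_C_; nCk≡n!/k![n-k]!; k![n∸k]!∣n!)
open import Data.Nat.DivMod using (m/n*n≡m)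
open import Data.Integer as ℤ using (ℤ; +_; -[1+_]; 0ℤ; 1ℤ; _+_; _*_; -_; _-_; _≤_; _<_; +≤+; +<+)
open import Data.Integer.Properties
open import Data.Integer.Tactic.RingSolver using (solve-∀)
open import Data.Rational as ℚ using (ℚ; 0ℚ)
import Data.Rational.Properties as ℚₚ
import Data.Rational.Unnormalised as ℚᵘ
import Data.Rational.Unnormalised.Properties as ℚᵘₚ
open import Data.Bool using (Bool; true; false; not; if_then_else_; _∧_; T)
open import Data.Bool.Properties using (T?)
import Data.Bool.Properties as Bool
open import Data.Empty using (⊥; ⊥-elim)
open import Data.Unit using (tt)
open import Data.Maybe using (just; nothing)
open import Data.Product using (_×_; _,_; ∃-syntax; proj₁; proj₂)
open import Data.Sum using (_⊎_; inj₁; inj₂)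
import Data.Sum.Properties as ⊎
open import Data.Fin using (Fin; zero; suc)
import Data.Fin as Fin
open import Data.Fin.Properties using (all?)
open import Data.Vec using ([]; _∷_; lookup; _[_]≔_)
import Data.Vec as Vec
open import Data.Vec.Properties using (lookup∘update; lookup∘update′; []≔-commutes)
open import Data.List using (List; []; _∷_; _++_; map; length; allFin; tabulate; filter)
open import Data.List.Properties using (map-tabulate; length-tabulate; filter-++; filter-none; filter-≐; ++-identityʳ; map-++; map-∘)
open import Data.List.Extrema.Nat using (argmax; argmax-all; f[xs]≤f[argmax])
open import Data.List.Membership.Propositional using (_∈_)
open import Data.List.Membership.Propositional.Properties using (∈-allFin; ∈-map⁺; ∈-map⁻; ∈-++⁺ˡ; ∈-++⁺ʳ; ∈-filter⁺)
open import Data.List.Relation.Unary.All as All using (All; []; _∷_)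
open import Data.List.Relation.Unary.All.Properties using (all-filter)
open import Data.List.Relation.Unary.AllPairs using ([]; _∷_)
open import Data.List.Relation.Unary.Any using (here; there)
open import Data.List.Relation.Unary.Unique.Propositional using (Unique)
import Data.List.Relation.Unary.Unique.Propositional.Properties as Unique
open import Function using (_∘_; id)
open import Relation.Binary using (DecidableEquality)
open import Relation.Binary.PropositionalEquality hiding (J)
open import Relation.Nullary using (yes; no; ¬_)
open import Relation.Nullary.Decidable using (⌊_⌋; _×-dec_; _⊎-dec_; _→-dec_)
open import Relation.Unary using (Decidable)


-- f is the homogeneous multivariate Tutte polynomial of a matroid with parameter 1/q. Signatures
-- are handled without eigenvalues, by a reverse Cauchy-Schwarz inequality over the integers. The
-- obstacle is that a sum of two such forms need not satisfy it; hence the care to find one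
-- hyperplane on which both summands are nonpositive. The matroid enters only through the Hessians
-- of derivatives of f of order m - 2, where the parallel classes of a contraction control the sign.
-- The limit in q is replaced by a single integer q, large against the size of the middle layer: the
-- counts are integers, so an error of less than one unit disappears.

-- Integer inequalities.

sq≥0 : ∀ i → 0ℤ ≤ i * i
sq≥0 (+ n) rewrite sym (pos-* n n) = +≤+ z≤n
sq≥0 -[1+ n ] = +≤+ z≤n

sq>0 : ∀ {i} → i ≢ 0ℤ → 0ℤ < i * i
sq>0 {+ zero} i≢0 = ⊥-elim (i≢0 refl)
sq>0 {+ suc n} i≢0 = +<+ (s≤s z≤n)
sq>0 { -[1+ n ]} i≢0 = +<+ (s≤s z≤n)

*-nonNeg : ∀ {i j} → 0ℤ ≤ i → 0ℤ ≤ j → 0ℤ ≤ i * j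
*-nonNeg {i} {j} 0≤i 0≤j = ≤-trans (≤-reflexive (sym (*-zeroʳ i))) (*-monoˡ-≤-nonNeg i {{ℤ.nonNegative 0≤i}} 0≤j)

*-nonPosʳ : ∀ {i j} → 0ℤ ≤ i → j ≤ 0ℤ → i * j ≤ 0ℤ
*-nonPosʳ {i} 0≤i j≤0 = ≤-trans (*-monoˡ-≤-nonNeg i {{ℤ.nonNegative 0≤i}} j≤0) (≤-reflexive (*-zeroʳ i))

*-positive : ∀ {i j} → 0ℤ < i → 0ℤ < j → 0ℤ < i * j
*-positive {i} {j} 0<i 0<j = ≤-<-trans (≤-reflexive (sym (*-zeroʳ i))) (*-monoˡ-<-pos i {{ℤ.positive 0<i}} 0<j)

≤-gap : ∀ {i j} d → 0ℤ ≤ d → i + d ≡ j → i ≤ j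
≤-gap {i} d 0≤d eq = ≤-trans (≤-reflexive (sym (+-identityʳ i))) (≤-trans (+-monoʳ-≤ i 0≤d) (≤-reflexive eq))

*-cancelˡ-≤-pos′ : ∀ {k i j} → 0ℤ < k → k * i ≤ k * j → i ≤ j
*-cancelˡ-≤-pos′ {k} {i} {j} 0<k = *-cancelˡ-≤-pos i j k {{ℤ.positive 0<k}}

-- Symmetric bilinear forms with at most one positive direction.

module _ {I : Set} where

  comb : ℤ → (I → ℤ) → ℤ → (I → ℤ) → (I → ℤ)
  comb a u b v i = a * u i + b * v i

  Linear : ((I → ℤ) → ℤ) → Set
  Linear h = ∀ a u b v → h (comb a u b v) ≡ a * h u + b * h v

  record IsForm (A : (I → ℤ) → (I → ℤ) → ℤ) : Set where
    field
      sym-form : ∀ u v → A u v ≡ A v u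
      linear   : ∀ w → Linear (A w)

    expand : ∀ a u b v →
             A (comb a u b v) (comb a u b v) ≡ a * a * A u u + (+ 2) * (a * b * A u v) + b * b * A v v
    expand a u b v
      rewrite linear (comb a u b v) a u b v
            | sym-form (comb a u b v) u | sym-form (comb a u b v) v
            | linear u a u b v | linear v a u b v | sym-form v u
      = regroup a b (A u u) (A u v) (A v v)
      where
      regroup : ∀ a b p q r → a * (a * p + b * q) + b * (a * q + b * r)
                              ≡ a * a * p + (+ 2) * (a * b * q) + b * b * r
      regroup = solve-∀

  open IsForm public

  -- The reverse Cauchy-Schwarz inequality encodes "at most one positive eigenvalue" within the
  -- integers: on a positive definite plane it would contradict the usual inequality. Vectors with
  -- `A v v` negative are excluded because negative definite planes are allowed.
  Lorentzian : ((I → ℤ) → (I → ℤ) → ℤ) → Set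
  Lorentzian A = ∀ u v → 0ℤ ≤ A v v → A u u * A v v ≤ A u v * A u v

  NonPosOnKernel : ((I → ℤ) → ℤ) → ((I → ℤ) → (I → ℤ) → ℤ) → Set
  NonPosOnKernel h A = ∀ u → h u ≡ 0ℤ → A u u ≤ 0ℤ

  -- If h(v) = 0, then A(v,v) = 0 and nothing is left to show. Otherwise w = h(v) u - h(u) v lies in
  -- the kernel, and A(v,v) A(w,w) = h(v)^2 (A(u,u) A(v,v) - A(u,v)^2) + (h(v) A(u,v) - h(u)
  -- A(v,v))^2 is nonpositive.
  nonPosOnKernel⇒lorentzian : ∀ {h A} → IsForm A → Linear h → NonPosOnKernel h A → Lorentzian A
  nonPosOnKernel⇒lorentzian {h} {A} isForm lin neg u v 0≤c with h v ≟ 0ℤ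
  ... | yes hv≡0 rewrite ≤-antisym (neg v hv≡0) 0≤c | *-zeroʳ (A u u) = sq≥0 (A u v)
  ... | no hv≢0 = *-cancelˡ-≤-pos′ (sq>0 hv≢0)
        (≤-gap _ (≤-trans (sq≥0 (h v * A u v - h u * A v v)) (≤-gap _ (neg-mono-≤ cAww≤0) refl))
          (identity (h u) (h v) (A u u) (A u v) (A v v)))
    where
    w : I → ℤ
    w = comb (h v) u (- h u) v
    cancel : ∀ a b → a * b + - b * a ≡ 0ℤ
    cancel = solve-∀
    Aww≤0 : A w w ≤ 0ℤ
    Aww≤0 = neg w (trans (lin (h v) u (- h u) v) (cancel (h v) (h u)))
    cAww≤0 : A v v * (h v * h v * A u u + (+ 2) * (h v * (- h u) * A u v) + (- h u) * (- h u) * A v v) ≤ 0ℤ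
    cAww≤0 = *-nonPosʳ 0≤c (≤-trans (≤-reflexive (sym (expand isForm (h v) u (- h u) v))) Aww≤0)
    identity : ∀ hu hv p q c →
      hv * hv * (p * c) + ((hv * q - hu * c) * (hv * q - hu * c)
        + - (c * (hv * hv * p + (+ 2) * (hv * (- hu) * q) + (- hu) * (- hu) * c)))
      ≡ hv * hv * (q * q)
    identity = solve-∀

  -- Suppose u is orthogonal to the isotropic vector y and A(u,u) > 0. Moving z along y keeps A(u,z)
  -- fixed while A(z,z) grows linearly, so the reverse Cauchy-Schwarz inequality eventually fails.
  isotropic-kernel : ∀ {A y z} → IsForm A → Lorentzian A → A y y ≡ 0ℤ → 0ℤ < A y z → 0ℤ ≤ A z z →
                     NonPosOnKernel (A y) A
  isotropic-kernel {A} {y} {z} isForm lor Ayy≡0 0<Ayz 0≤Azz u Ayu≡0 with A u u ≤? 0ℤ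
  ... | yes p = p
  ... | no ¬p = ⊥-elim (<⇒≱ b²<Avv (≤-trans Avv≤AuuAvv (≤-trans (lor u v (≤-trans (sq≥0 b) (<⇒≤ b²<Avv))) (≤-reflexive (cong₂ _*_ Auv≡b Auv≡b)))))
    where
    b t : ℤ
    b = A u z
    -- Large enough for A(v,v) = A(z,z) + 2t A(y,z) to exceed b^2 = A(u,v)^2, since A(y,z), a
    -- positive integer, is at least 1. For the same reason A(u,u) is at least 1.
    t = 1ℤ + b * b
    v : I → ℤ
    v = comb 1ℤ z t y
    Auv≡b : A u v ≡ b
    Auv≡b rewrite linear isForm u 1ℤ z t y | sym-form isForm u y | Ayu≡0 = simplify (A u z) t
      where
      simplify : ∀ p t → 1ℤ * p + t * 0ℤ ≡ p
      simplify = solve-∀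
    Avv≡ : A v v ≡ A z z + (+ 2) * (t * A y z)
    Avv≡ rewrite expand isForm 1ℤ z t y | sym-form isForm z y | Ayy≡0 = simplify (A z z) t (A y z)
      where
      simplify : ∀ p t q → 1ℤ * 1ℤ * p + (+ 2) * (1ℤ * t * q) + t * t * 0ℤ ≡ p + (+ 2) * (t * q)
      simplify = solve-∀
    1≤Ayz : 1ℤ ≤ A y z
    1≤Ayz = i<j⇒suc[i]≤j 0<Ayz
    b²<Avv : b * b < A v v
    b²<Avv = suc[i]≤j⇒i<j (≤-gap _
      (+-mono-≤ 0≤Azz (+-mono-≤ (*-nonNeg {(+ 2) * t} (*-nonNeg {+ 2} (+≤+ z≤n) 0≤t) (i≤j⇒0≤j-i 1≤Ayz)) 0≤t))
      (trans (identity b (A z z) (A y z)) (sym Avv≡)))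
      where
      0≤t : 0ℤ ≤ t
      0≤t = +-mono-≤ {0ℤ} {1ℤ} (+≤+ z≤n) (sq≥0 b)
      identity : ∀ b p q → 1ℤ + b * b + (p + ((+ 2) * (1ℤ + b * b) * (q - 1ℤ) + (1ℤ + b * b))) ≡ p + (+ 2) * ((1ℤ + b * b) * q)
      identity = solve-∀
    0≤Avv : 0ℤ ≤ A v v
    0≤Avv = ≤-trans (sq≥0 b) (<⇒≤ b²<Avv)
    Avv≤AuuAvv : A v v ≤ A u u * A v v
    Avv≤AuuAvv = ≤-trans (≤-reflexive (sym (*-identityˡ (A v v))))
      (*-monoʳ-≤-nonNeg (A v v) {{ℤ.nonNegative 0≤Avv}} (i<j⇒suc[i]≤j (≰⇒> ¬p)))

  -- Both forms are nonpositive on the kernel of the common functional A(y,·) = B(x,·), hence so is their sum.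
  lorentzian-sum : ∀ {A B x y z} → IsForm A → IsForm B → Lorentzian A → Lorentzian B →
                   A y y ≡ 0ℤ → B x x ≡ 0ℤ → (∀ v → A y v ≡ B x v) →
                   0ℤ < A y z → 0ℤ ≤ A z z → 0ℤ ≤ B z z →
                   Lorentzian (λ u v → A u v + B u v)
  lorentzian-sum {A} {B} {x} {y} {z} formA formB lorA lorB Ayy≡0 Bxx≡0 shared 0<Ayz 0≤Azz 0≤Bzz =
    nonPosOnKernel⇒lorentzian form-sum (linear formA y)
      (λ u Ayu≡0 → +-mono-≤ (isotropic-kernel formA lorA Ayy≡0 0<Ayz 0≤Azz u Ayu≡0)
        (isotropic-kernel formB lorB Bxx≡0 (subst (0ℤ <_) (shared z) 0<Ayz) 0≤Bzz u (trans (sym (shared u)) Ayu≡0)))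
    where
    form-sum : IsForm (λ u v → A u v + B u v)
    form-sum .sym-form u v = cong₂ _+_ (sym-form formA u v) (sym-form formB u v)
    form-sum .linear w a u b v rewrite linear formA w a u b v | linear formB w a u b v =
      regroup a b (A w u) (A w v) (B w u) (B w v)
      where
      regroup : ∀ a b p q r s → a * p + b * q + (a * r + b * s) ≡ a * (p + r) + b * (q + s)
      regroup = solve-∀

  lorentzian-cong : ∀ {A B} → (∀ u v → A u v ≡ B u v) → Lorentzian A → Lorentzian B
  lorentzian-cong eq lor u v rewrite sym (eq u u) | sym (eq v v) | sym (eq u v) = lor u v

-- Finite sums, the Cauchy-Schwarz inequality and forms given by matrices.

module _ {I : Set} where

  ∑ : List I → (I → ℤ) → ℤ
  ∑ []       f = 0ℤ
  ∑ (i ∷ is) f = f i + ∑ is f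

  ∑-cong : ∀ is {f g : I → ℤ} → (∀ i → f i ≡ g i) → ∑ is f ≡ ∑ is g
  ∑-cong []       eq = refl
  ∑-cong (i ∷ is) eq = cong₂ _+_ (eq i) (∑-cong is eq)

  ∑-0 : ∀ is {f : I → ℤ} → (∀ i → f i ≡ 0ℤ) → ∑ is f ≡ 0ℤ
  ∑-0 []       eq = refl
  ∑-0 (i ∷ is) eq rewrite eq i | ∑-0 is eq = refl

  ∑-+ : ∀ is (f g : I → ℤ) → ∑ is (λ i → f i + g i) ≡ ∑ is f + ∑ is g
  ∑-+ []       f g = refl
  ∑-+ (i ∷ is) f g rewrite ∑-+ is f g = interchange (f i) (g i) (∑ is f) (∑ is g)
    where
    interchange : ∀ p q r s → p + q + (r + s) ≡ p + r + (q + s)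
    interchange = solve-∀

  ∑-*ˡ : ∀ is c (f : I → ℤ) → ∑ is (λ i → c * f i) ≡ c * ∑ is f
  ∑-*ˡ []       c f = sym (*-zeroʳ c)
  ∑-*ˡ (i ∷ is) c f rewrite ∑-*ˡ is c f = sym (*-distribˡ-+ c (f i) (∑ is f))

  ∑-*ʳ : ∀ is (f : I → ℤ) c → ∑ is (λ i → f i * c) ≡ ∑ is f * c
  ∑-*ʳ is f c = trans (∑-cong is (λ i → *-comm (f i) c)) (trans (∑-*ˡ is c f) (*-comm c (∑ is f)))

  ∑-++ : ∀ is js (f : I → ℤ) → ∑ (is ++ js) f ≡ ∑ is f + ∑ js f
  ∑-++ []       js f = sym (+-identityˡ _)
  ∑-++ (i ∷ is) js f rewrite ∑-++ is js f = sym (+-assoc (f i) (∑ is f) (∑ js f))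

  ∑-mono : ∀ is {f g : I → ℤ} → (∀ i → f i ≤ g i) → ∑ is f ≤ ∑ is g
  ∑-mono []       le = ≤-refl
  ∑-mono (i ∷ is) le = +-mono-≤ (le i) (∑-mono is le)

  ∑-nonNeg : ∀ is {f : I → ℤ} → (∀ i → 0ℤ ≤ f i) → 0ℤ ≤ ∑ is f
  ∑-nonNeg is le = ≤-trans (≤-reflexive (sym (∑-0 is (λ _ → refl)))) (∑-mono is le)

∑-map : ∀ {I J : Set} (φ : I → J) is (f : J → ℤ) → ∑ (map φ is) f ≡ ∑ is (λ i → f (φ i))
∑-map φ []       f = refl
∑-map φ (i ∷ is) f = cong (_+_ (f (φ i))) (∑-map φ is f)

module _ {I J : Set} where

  ∑-swap : ∀ is js (f : I → J → ℤ) →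
           ∑ is (λ i → ∑ js (λ j → f i j)) ≡ ∑ js (λ j → ∑ is (λ i → f i j))
  ∑-swap []       js f = sym (∑-0 js (λ _ → refl))
  ∑-swap (i ∷ is) js f rewrite ∑-swap is js f = sym (∑-+ js (f i) (λ j → ∑ is (λ k → f k j)))

  ∑-product : ∀ is js (f : I → ℤ) (g : J → ℤ) →
              ∑ is (λ i → ∑ js (λ j → f i * g j)) ≡ ∑ is f * ∑ js g
  ∑-product is js f g = trans (∑-cong is (λ i → ∑-*ˡ js (f i) g)) (∑-*ʳ is f (∑ js g))

module _ {I : Set} (is : List I) where

  -- Lagrange's identity: the double sum of (a_i b_j - a_j b_i)^2 is twice the difference of the two
  -- sides.
  cauchy-schwarz : ∀ (a b : I → ℤ) →
    ∑ is (λ i → a i * b i) * ∑ is (λ i → a i * b i) ≤ ∑ is (λ i → a i * a i) * ∑ is (λ i → b i * b i)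
  cauchy-schwarz a b = *-cancelˡ-≤-pos′ {+ 2} (+<+ (s≤s z≤n))
    (≤-gap _ (∑-nonNeg is (λ i → ∑-nonNeg is (λ j → sq≥0 (a i * b j - a j * b i)))) total)
    where
    A B U : ℤ
    U = ∑ is (λ i → a i * b i)
    A = ∑ is (λ i → a i * a i)
    B = ∑ is (λ i → b i * b i)
    pointwise : ∀ p q r s → (p * q - r * s) * (p * q - r * s)
                ≡ (p * p) * (q * q) + ((s * s) * (r * r) + (- (+ 2) * (p * s)) * (r * q))
    pointwise = solve-∀
    rearrange : ∀ U A B → (+ 2) * (U * U) + (A * B + (B * A + (- (+ 2) * U) * U)) ≡ (+ 2) * (A * B)
    rearrange = solve-∀
    double-sum : ∑ is (λ i → ∑ is (λ j → (a i * b j - a j * b i) * (a i * b j - a j * b i)))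
                 ≡ A * B + (B * A + (- (+ 2) * U) * U)
    double-sum = begin
      ∑ is (λ i → ∑ is (λ j → (a i * b j - a j * b i) * (a i * b j - a j * b i)))
        ≡⟨ ∑-cong is (λ i → ∑-cong is (λ j → pointwise (a i) (b j) (a j) (b i))) ⟩
      ∑ is (λ i → ∑ is (λ j → f i j + (g i j + h i j)))
        ≡⟨ ∑-cong is (λ i → trans (∑-+ is (f i) (λ j → g i j + h i j)) (cong (_+_ (∑ is (f i))) (∑-+ is (g i) (h i)))) ⟩
      ∑ is (λ i → ∑ is (f i) + (∑ is (g i) + ∑ is (h i)))
        ≡⟨ trans (∑-+ is (λ i → ∑ is (f i)) (λ i → ∑ is (g i) + ∑ is (h i))) (cong (_+_ (∑ is (λ i → ∑ is (f i)))) (∑-+ is (λ i → ∑ is (g i)) (λ i → ∑ is (h i)))) ⟩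
      ∑ is (λ i → ∑ is (f i)) + (∑ is (λ i → ∑ is (g i)) + ∑ is (λ i → ∑ is (h i)))
        ≡⟨ cong₂ _+_ (∑-product is is (λ i → a i * a i) (λ j → b j * b j))
            (cong₂ _+_ (∑-product is is (λ i → b i * b i) (λ j → a j * a j))
              (trans (∑-product is is (λ i → - (+ 2) * (a i * b i)) (λ j → a j * b j)) (cong (_* U) (∑-*ˡ is (- (+ 2)) (λ i → a i * b i))))) ⟩
      A * B + (B * A + (- (+ 2) * U) * U) ∎
      where
      open ≡-Reasoning
      f g h : I → I → ℤ
      f i j = (a i * a i) * (b j * b j)
      g i j = (b i * b i) * (a j * a j)
      h i j = (- (+ 2) * (a i * b i)) * (a j * b j)
    total : (+ 2) * (U * U) + ∑ is (λ i → ∑ is (λ j → (a i * b j - a j * b i) * (a i * b j - a j * b i))) ≡ (+ 2) * (A * B)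
    total = trans (cong (_+_ ((+ 2) * (U * U))) double-sum) (rearrange U A B)

  ⟪_⟫ : (I → I → ℤ) → (I → ℤ) → (I → ℤ) → ℤ
  ⟪ T ⟫ u v = ∑ is (λ i → ∑ is (λ j → T i j * (u i * v j)))

  ⟪⟫-form : ∀ {T} → (∀ i j → T i j ≡ T j i) → IsForm ⟪ T ⟫
  ⟪⟫-form {T} T-sym .sym-form u v = trans (∑-swap is is _)
    (∑-cong is (λ j → ∑-cong is (λ i → cong₂ _*_ (T-sym i j) (*-comm (u i) (v j)))))
  ⟪⟫-form {T} T-sym .linear w a u b v = begin
    ∑ is (λ i → ∑ is (λ j → T i j * (w i * (a * u j + b * v j))))
      ≡⟨ ∑-cong is (λ i → ∑-cong is (λ j → regroup (T i j) (w i) a (u j) b (v j))) ⟩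
    ∑ is (λ i → ∑ is (λ j → a * f i j + b * g i j))
      ≡⟨ ∑-cong is (λ i → trans (∑-+ is (λ j → a * f i j) (λ j → b * g i j)) (cong₂ _+_ (∑-*ˡ is a (f i)) (∑-*ˡ is b (g i)))) ⟩
    ∑ is (λ i → a * ∑ is (f i) + b * ∑ is (g i))
      ≡⟨ trans (∑-+ is (λ i → a * ∑ is (f i)) (λ i → b * ∑ is (g i))) (cong₂ _+_ (∑-*ˡ is a (λ i → ∑ is (f i))) (∑-*ˡ is b (λ i → ∑ is (g i)))) ⟩
    a * ⟪ T ⟫ w u + b * ⟪ T ⟫ w v ∎
    where
    open ≡-Reasoning
    f g : I → I → ℤ
    f i j = T i j * (w i * u j)
    g i j = T i j * (w i * v j)
    regroup : ∀ t w a u b v → t * (w * (a * u + b * v)) ≡ a * (t * (w * u)) + b * (t * (w * v))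
    regroup = solve-∀

  ⟪⟫-+ : ∀ T U u v → ⟪ T ⟫ u v + ⟪ U ⟫ u v ≡ ⟪ (λ i j → T i j + U i j) ⟫ u v
  ⟪⟫-+ T U u v = sym (trans
    (∑-cong is (λ i → trans (∑-cong is (λ j → *-distribʳ-+ (u i * v j) (T i j) (U i j)))
      (∑-+ is (λ j → T i j * (u i * v j)) (λ j → U i j * (u i * v j)))))
    (∑-+ is _ _))

module Basis {I : Set} (_≟ᴵ_ : DecidableEquality I) where

  δ : I → I → ℤ
  δ i j = if ⌊ i ≟ᴵ j ⌋ then 1ℤ else 0ℤ

  ∑-δ-∉ : ∀ {is y} → All (λ i → y ≢ i) is → ∀ (f : I → ℤ) → ∑ is (λ i → δ y i * f i) ≡ 0ℤ
  ∑-δ-∉ [] f = refl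
  ∑-δ-∉ {i ∷ is} {y} (y≢i ∷ y≢is) f with y ≟ᴵ i
  ... | yes y≡i = ⊥-elim (y≢i y≡i)
  ... | no _ = trans (+-identityˡ _) (∑-δ-∉ y≢is f)

  ∑-δ : ∀ {is y} → Unique is → y ∈ is → ∀ (f : I → ℤ) → ∑ is (λ i → δ y i * f i) ≡ f y
  ∑-δ {i ∷ is} {y} (i≢is ∷ uniq) y∈ f with y ≟ᴵ i
  ... | yes refl = trans (cong (_+_ (1ℤ * f y)) (∑-δ-∉ i≢is f)) (trans (+-identityʳ _) (*-identityˡ (f y)))
  ... | no y≢i with y∈
  ...   | here y≡i = ⊥-elim (y≢i y≡i)
  ...   | there y∈is = trans (+-identityˡ _) (∑-δ uniq y∈is f)

  module _ {is : List I} (uniq : Unique is) (complete : (i : I) → i ∈ is) where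

    ⟪⟫-δˡ : ∀ T y v → ⟪_⟫ is T (δ y) v ≡ ∑ is (λ j → T y j * v j)
    ⟪⟫-δˡ T y v = trans (∑-cong is (λ i → trans (∑-cong is (λ j → regroup (T i j) (δ y i) (v j))) (∑-*ˡ is (δ y i) _)))
      (∑-δ uniq (complete y) (λ i → ∑ is (λ j → T i j * v j)))
      where
      regroup : ∀ t d v → t * (d * v) ≡ d * (t * v)
      regroup = solve-∀

    ⟪⟫-δδ : ∀ T y z → ⟪_⟫ is T (δ y) (δ z) ≡ T y z
    ⟪⟫-δδ T y z = trans (⟪⟫-δˡ T y (δ z)) (trans (∑-cong is (λ j → *-comm (T y j) (δ z j))) (∑-δ uniq (complete z) (T y)))

-- Distributing elements over two sets, and elementary Lorentzian forms.

add : ∀ {n} → Fin n → Config n → Config n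
add e X = X [ e ]≔ true

∣add∣ : ∀ {n} (X : Config n) e → lookup X e ≡ false → ∣ add e X ∣ ≡ suc ∣ X ∣
∣add∣ (false ∷ X) zero    _  = refl
∣add∣ (false ∷ X) (suc e) eq = ∣add∣ X e eq
∣add∣ (true ∷ X)  (suc e) eq = cong suc (∣add∣ X e eq)

∣∣≤∣add∣ : ∀ {n} (X : Config n) e → ∣ X ∣ ℕ.≤ ∣ add e X ∣
∣∣≤∣add∣ (false ∷ X) zero    = ℕₚ.n≤1+n _
∣∣≤∣add∣ (true ∷ X)  zero    = ℕₚ.≤-refl
∣∣≤∣add∣ (false ∷ X) (suc e) = ∣∣≤∣add∣ X e
∣∣≤∣add∣ (true ∷ X)  (suc e) = s≤s (∣∣≤∣add∣ X e)

splitSum : ∀ {n} → (Config n → Config n → ℤ) → Config n → Config n → List (Fin n) → ℤ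
splitSum g X Y []       = g X Y
splitSum g X Y (e ∷ es) = splitSum g (add e X) Y es + splitSum g X (add e Y) es

splitSum-nonNeg : ∀ {n} {g : Config n → Config n → ℤ} → (∀ X Y → 0ℤ ≤ g X Y) →
                  ∀ X Y es → 0ℤ ≤ splitSum g X Y es
splitSum-nonNeg 0≤g X Y []       = 0≤g X Y
splitSum-nonNeg 0≤g X Y (e ∷ es) = +-mono-≤ (splitSum-nonNeg 0≤g (add e X) Y es) (splitSum-nonNeg 0≤g X (add e Y) es)

splitSum-cong : ∀ {n} {g h : Config n → Config n → ℤ} → (∀ X Y → g X Y ≡ h X Y) →
                ∀ X Y es → splitSum g X Y es ≡ splitSum h X Y es
splitSum-cong eq X Y []       = eq X Y
splitSum-cong eq X Y (e ∷ es) = cong₂ _+_ (splitSum-cong eq (add e X) Y es) (splitSum-cong eq X (add e Y) es)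

-- Together with uniqueness of `es` this ensures that every `add` made by `splitSum` raises a
-- cardinality by one, so that degrees can be counted.
Fresh : ∀ {n} → Config n → Config n → List (Fin n) → Set
Fresh X Y es = All (λ e → lookup X e ≡ false × lookup Y e ≡ false) es

fresh-addˡ : ∀ {n} (X Y : Config n) {e es} → All (e ≢_) es → Fresh X Y es → Fresh (add e X) Y es
fresh-addˡ X Y []           []               = []
fresh-addˡ X Y (e≢f ∷ e≢es) ((fX , fY) ∷ fs) = (trans (lookup∘update′ (e≢f ∘ sym) X true) fX , fY) ∷ fresh-addˡ X Y e≢es fs

fresh-addʳ : ∀ {n} (X Y : Config n) {e es} → All (e ≢_) es → Fresh X Y es → Fresh X (add e Y) es
fresh-addʳ X Y []           []               = []
fresh-addʳ X Y (e≢f ∷ e≢es) ((fX , fY) ∷ fs) = (fX , trans (lookup∘update′ (e≢f ∘ sym) Y true) fY) ∷ fresh-addʳ X Y e≢es fs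

lorentzian-zero : ∀ {I : Set} {A : (I → ℤ) → (I → ℤ) → ℤ} → (∀ u v → A u v ≡ 0ℤ) → Lorentzian A
lorentzian-zero {A = A} A≡0 u v _ rewrite A≡0 u u = sq≥0 (A u v)

-- This form is the Hessian of the product of the linear forms f and g. The two sides differ by the
-- square of f(u) g(v) - f(v) g(u).
lorentzian-rank2 : ∀ {I : Set} (f g : (I → ℤ) → ℤ) → Lorentzian (λ u v → f u * g v + f v * g u)
lorentzian-rank2 f g u v _ = ≤-gap _ (sq≥0 (f u * g v - f v * g u)) (identity (f u) (f v) (g u) (g v))
  where
  identity : ∀ p q r s → (p * r + p * r) * (q * s + q * s) + (p * s - q * r) * (p * s - q * r) ≡ (p * s + q * r) * (p * s + q * r)
  identity = solve-∀

-- Used for a product whose factors have separate variables: `φ` includes the variables of the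
-- quadratic factor among all variables, and c is the other factor, a constant.
lorentzian-scale : ∀ {I J : Set} (φ : I → J) {A : (I → ℤ) → (I → ℤ) → ℤ} {c} → 0ℤ ≤ c → Lorentzian A →
                   Lorentzian (λ u v → A (u ∘ φ) (v ∘ φ) * c)
lorentzian-scale φ {A} {+ zero} _ lor = lorentzian-zero (λ u v → *-zeroʳ (A (u ∘ φ) (v ∘ φ)))
lorentzian-scale φ {A} {c@(+ suc n)} 0≤c lor u v 0≤Avvc = ≤-trans (≤-reflexive (regroup (A u′ u′) (A v′ v′) c))
  (≤-trans (*-monoˡ-≤-nonNeg (c * c) {{ℤ.nonNegative (sq≥0 c)}} (lor u′ v′ (*-cancelʳ-≤-pos 0ℤ (A v′ v′) c 0≤Avvc)))
    (≤-reflexive (sym (regroup (A u′ v′) (A u′ v′) c))))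
  where
  u′ = u ∘ φ
  v′ = v ∘ φ
  regroup : ∀ p q c → p * c * (q * c) ≡ c * c * (p * q)
  regroup = solve-∀

-- Hessians of f(s,x) f(t,y) under the operators ∂/∂x_e + ∂/∂y_e.

module Bipartitions (m a : ℕ) (m≡ : m ≡ suc a ℕ.+ suc a) (W : Config m → ℤ) (0<W : ∀ X → 0ℤ < W X) where

  Idx Var : Set
  Idx = Fin (suc m)
  Var = Idx ⊎ Idx

  idxs : List Idx
  idxs = allFin (suc m)

  vars : List Var
  vars = map inj₁ idxs ++ map inj₂ idxs

  -- The coefficients of the iterated derivatives of f(s,x) = Σ_X W(X) x^X s^(m-|X|), with respect to x^X s^b and then
  -- to the listed variables, where index zero is s and suc e is x_e.
  τ : ℕ → List Idx → Config m → ℤ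
  τ b []          X = if ⌊ ∣ X ∣ ℕ.+ b ℕₚ.≟ m ⌋ then + (b !) * W X else 0ℤ
  τ b (zero ∷ L)  X = τ (suc b) L X
  τ b (suc e ∷ L) X = if lookup X e then 0ℤ else τ b L (add e X)

  lefts rights : List Var → List Idx
  lefts []           = []
  lefts (inj₁ i ∷ L) = i ∷ lefts L
  lefts (inj₂ i ∷ L) = lefts L
  rights []           = []
  rights (inj₁ i ∷ L) = rights L
  rights (inj₂ i ∷ L) = i ∷ rights L

  -- Both ∂/∂s and ∂/∂t are applied `a` times in advance. From degree 2m, these 2a derivatives and
  -- the m operators ∂/∂x_e + ∂/∂y_e lead down to m - 2a = 2, so with `L` of length two the entries
  -- of the final Hessian are numbers.
  F : List Var → Config m → Config m → ℤ
  F L X Y = τ a (lefts L) X * τ a (rights L) Y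

  -- Summing over the splits of es applies the operators ∂/∂x_e + ∂/∂y_e, e ∈ es, to f(s,x) f(t,y).
  G : List Var → Config m → Config m → List (Fin m) → ℤ
  G L = splitSum (F L)

  τ-fresh : ∀ {b e L X} → lookup X e ≡ false → τ b (suc e ∷ L) X ≡ τ b L (add e X)
  τ-fresh eq rewrite eq = refl

  τ-absorbed : ∀ {b e L X} → lookup X e ≡ true → τ b (suc e ∷ L) X ≡ 0ℤ
  τ-absorbed eq rewrite eq = refl

  -- `τ` is the value at the origin of a derivative of order |X| + b + |L| of a homogeneous
  -- polynomial of degree m, hence zero unless the order is m.
  τ-degree : ∀ b L X → ∣ X ∣ ℕ.+ b ℕ.+ length L ≢ m → τ b L X ≡ 0ℤ
  τ-degree b [] X ≢m with ∣ X ∣ ℕ.+ b ℕₚ.≟ m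
  ... | yes eq = ⊥-elim (≢m (trans (ℕₚ.+-identityʳ _) eq))
  ... | no _   = refl
  τ-degree b (zero ∷ L) X ≢m = τ-degree (suc b) L X (≢m ∘ trans (shift ∣ X ∣ b (length L)))
    where
    shift : ∀ x b l → x ℕ.+ b ℕ.+ suc l ≡ x ℕ.+ suc b ℕ.+ l
    shift = ℕ-Solver.solve-∀
  τ-degree b (suc e ∷ L) X ≢m with lookup X e in eq
  ... | true  = refl
  ... | false = τ-degree b L (add e X) (≢m ∘ trans (trans (shift ∣ X ∣ b (length L)) (cong (λ x → x ℕ.+ b ℕ.+ length L) (sym (∣add∣ X e eq)))))
    where
    shift : ∀ x b l → x ℕ.+ b ℕ.+ suc l ≡ suc x ℕ.+ b ℕ.+ l
    shift = ℕ-Solver.solve-∀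

  τ-degree-a : ∀ L X → ∣ X ∣ ℕ.+ length L ≢ suc (suc a) → τ a L X ≡ 0ℤ
  τ-degree-a L X ≢2+a = τ-degree a L X (λ eq → ≢2+a (ℕₚ.+-cancelʳ-≡ a _ _ (trans (shift ∣ X ∣ (length L) a) (trans eq (trans m≡ (cong suc (ℕₚ.+-suc a a)))))))
    where
    shift : ∀ x l a → x ℕ.+ l ℕ.+ a ≡ x ℕ.+ a ℕ.+ l
    shift = ℕ-Solver.solve-∀

  τ-nonNeg : ∀ b L X → 0ℤ ≤ τ b L X
  τ-nonNeg b [] X with ∣ X ∣ ℕ.+ b ℕₚ.≟ m
  ... | yes _ = *-nonNeg {+ (b !)} (+≤+ z≤n) (<⇒≤ (0<W X))
  ... | no _  = ≤-refl
  τ-nonNeg b (zero ∷ L) X = τ-nonNeg (suc b) L X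
  τ-nonNeg b (suc e ∷ L) X with lookup X e
  ... | true  = ≤-refl
  ... | false = τ-nonNeg b L (add e X)

  τ-[] : ∀ b X → ∣ X ∣ ℕ.+ b ≡ m → τ b [] X ≡ + (b !) * W X
  τ-[] b X eq with ∣ X ∣ ℕ.+ b ℕₚ.≟ m
  ... | yes _  = refl
  ... | no neq = ⊥-elim (neq eq)

  τ-positive : ∀ b X → ∣ X ∣ ℕ.+ b ≡ m → 0ℤ < τ b [] X
  τ-positive b X eq rewrite τ-[] b X eq = *-positive (+<+ (ℕₚ.n≢0⇒n>0 (ℕ.≢-nonZero⁻¹ (b !) {{b ℕₚ.!≢0}}))) (0<W X)

  τ-swap : ∀ b i j L X → τ b (i ∷ j ∷ L) X ≡ τ b (j ∷ i ∷ L) X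
  τ-swap b zero    zero    L X = refl
  τ-swap b zero    (suc f) L X = refl
  τ-swap b (suc e) zero    L X = refl
  τ-swap b (suc e) (suc f) L X with e Fin.≟ f
  ... | yes refl = refl
  ... | no e≢f rewrite lookup∘update′ e≢f X true | lookup∘update′ (e≢f ∘ sym) X true | []≔-commutes {x = true} {y = true} X e f e≢f
    with lookup X e | lookup X f
  ... | true  | true  = refl
  ... | true  | false = refl
  ... | false | true  = refl
  ... | false | false = refl

  F-nonNeg : ∀ L X Y → 0ℤ ≤ F L X Y
  F-nonNeg L X Y = *-nonNeg (τ-nonNeg a (lefts L) X) (τ-nonNeg a (rights L) Y)

  F-swap : ∀ i j X Y → F (i ∷ j ∷ []) X Y ≡ F (j ∷ i ∷ []) X Y
  F-swap (inj₁ i) (inj₁ j) X Y = cong (_* τ a [] Y) (τ-swap a i j [] X)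
  F-swap (inj₁ i) (inj₂ j) X Y = refl
  F-swap (inj₂ i) (inj₁ j) X Y = refl
  F-swap (inj₂ i) (inj₂ j) X Y = cong (τ a [] X *_) (τ-swap a i j [] Y)

  -- Differentiating in x_e amounts to moving e into X, and this commutes with the splits because e
  -- is not among `es`. Together with `G-addʳ` it identifies the row of y_e in one Hessian with the
  -- row of x_e in the other.
  G-addˡ : ∀ {e es} L X Y → lookup X e ≡ false → All (e ≢_) es → G (inj₁ (suc e) ∷ L) X Y es ≡ G L (add e X) Y es
  G-addˡ {e} L X Y eX [] = cong (_* τ a (rights L) Y) (τ-fresh {a} {e} {lefts L} {X} eX)
  G-addˡ {e} {f ∷ es} L X Y eX (e≢f ∷ e≢es) = cong₂ _+_
    (trans (G-addˡ L (add f X) Y (trans (lookup∘update′ e≢f X true) eX) e≢es)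
      (cong (λ Z → G L Z Y es) ([]≔-commutes X f e (e≢f ∘ sym))))
    (G-addˡ L X (add f Y) eX e≢es)

  G-addʳ : ∀ {e es} L X Y → lookup Y e ≡ false → All (e ≢_) es → G (inj₂ (suc e) ∷ L) X Y es ≡ G L X (add e Y) es
  G-addʳ {e} L X Y eY [] = cong (τ a (lefts L) X *_) (τ-fresh {a} {e} {rights L} {Y} eY)
  G-addʳ {e} {f ∷ es} L X Y eY (e≢f ∷ e≢es) = cong₂ _+_
    (G-addʳ L (add f X) Y eY e≢es)
    (trans (G-addʳ L X (add f Y) (trans (lookup∘update′ e≢f Y true) eY) e≢es)
      (cong (λ Z → G L X Z es) ([]≔-commutes Y f e (e≢f ∘ sym))))

  -- f has degree at most one in each x_e, so a second derivative in x_e vanishes. This and its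
  -- mirror image `G-absorbedʳ` supply the isotropic vectors required by `lorentzian-sum`.
  G-absorbedˡ : ∀ {e es} L X Y → lookup X e ≡ true → All (e ≢_) es → G (inj₁ (suc e) ∷ L) X Y es ≡ 0ℤ
  G-absorbedˡ {e} L X Y eX [] = cong (_* τ a (rights L) Y) (τ-absorbed {a} {e} {lefts L} {X} eX)
  G-absorbedˡ {e} {f ∷ es} L X Y eX (e≢f ∷ e≢es) = cong₂ _+_
    (G-absorbedˡ L (add f X) Y (trans (lookup∘update′ e≢f X true) eX) e≢es)
    (G-absorbedˡ L X (add f Y) eX e≢es)

  G-absorbedʳ : ∀ {e es} L X Y → lookup Y e ≡ true → All (e ≢_) es → G (inj₂ (suc e) ∷ L) X Y es ≡ 0ℤ
  G-absorbedʳ {e} L X Y eY [] = trans (cong (τ a (lefts L) X *_) (τ-absorbed {a} {e} {rights L} {Y} eY)) (*-zeroʳ (τ a (lefts L) X))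
  G-absorbedʳ {e} {f ∷ es} L X Y eY (e≢f ∷ e≢es) = cong₂ _+_
    (G-absorbedʳ L (add f X) Y eY e≢es)
    (G-absorbedʳ L X (add f Y) (trans (lookup∘update′ e≢f Y true) eY) e≢es)

  -- The derivatives recorded by X and the `a` derivatives in s already have order above m = 2a + 2,
  -- and splitting only enlarges X.
  G-highˡ : ∀ L X Y es → suc (suc a) ℕ.< ∣ X ∣ → G L X Y es ≡ 0ℤ
  G-highˡ L X Y [] high = cong (_* τ a (rights L) Y) (τ-degree-a (lefts L) X (ℕₚ.>⇒≢ (ℕₚ.≤-trans high (ℕₚ.m≤m+n ∣ X ∣ _))))
  G-highˡ L X Y (e ∷ es) high = cong₂ _+_
    (G-highˡ L (add e X) Y es (ℕₚ.≤-trans high (∣∣≤∣add∣ X e)))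
    (G-highˡ L X (add e Y) es high)

  G-highʳ : ∀ L X Y es → suc (suc a) ℕ.< ∣ Y ∣ → G L X Y es ≡ 0ℤ
  G-highʳ L X Y [] high = trans (cong (τ a (lefts L) X *_) (τ-degree-a (rights L) Y (ℕₚ.>⇒≢ (ℕₚ.≤-trans high (ℕₚ.m≤m+n ∣ Y ∣ _)))))
    (*-zeroʳ (τ a (lefts L) X))
  G-highʳ L X Y (e ∷ es) high = cong₂ _+_
    (G-highʳ L (add e X) Y es high)
    (G-highʳ L X (add e Y) es (ℕₚ.≤-trans high (∣∣≤∣add∣ Y e)))

  -- One positive summand suffices, the others being nonnegative. It sends the first i elements of
  -- `es` to X and the other j to Y; the two degree equations say that both sides then have order
  -- exactly m, where `τ` is a positive multiple of a weight.
  splitSum-positive : ∀ b c i j X Y es → Fresh X Y es → Unique es → length es ≡ i ℕ.+ j →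
    ∣ X ∣ ℕ.+ i ℕ.+ b ≡ m → ∣ Y ∣ ℕ.+ j ℕ.+ c ≡ m → 0ℤ < splitSum (λ X Y → τ b [] X * τ c [] Y) X Y es
  splitSum-positive b c zero zero X Y [] _ _ _ degX degY =
    *-positive (τ-positive b X (subst (λ x → x ℕ.+ b ≡ m) (ℕₚ.+-identityʳ ∣ X ∣) degX))
               (τ-positive c Y (subst (λ x → x ℕ.+ c ≡ m) (ℕₚ.+-identityʳ ∣ Y ∣) degY))
  splitSum-positive b c (suc i) j X Y (e ∷ es) ((eX , eY) ∷ fs) (e≢es ∷ uniq) len degX degY =
    +-mono-<-≤ (splitSum-positive b c i j (add e X) Y es (fresh-addˡ X Y e≢es fs) uniq (ℕₚ.suc-injective len)
                 (trans (cong (ℕ._+ b) (trans (cong (ℕ._+ i) (∣add∣ X e eX)) (sym (ℕₚ.+-suc ∣ X ∣ i)))) degX) degY)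
               (splitSum-nonNeg (λ X Y → *-nonNeg (τ-nonNeg b [] X) (τ-nonNeg c [] Y)) X (add e Y) es)
  splitSum-positive b c zero (suc j) X Y (e ∷ es) ((eX , eY) ∷ fs) (e≢es ∷ uniq) len degX degY =
    +-mono-≤-< (splitSum-nonNeg (λ X Y → *-nonNeg (τ-nonNeg b [] X) (τ-nonNeg c [] Y)) (add e X) Y es)
               (splitSum-positive b c zero j X (add e Y) es (fresh-addʳ X Y e≢es fs) uniq (ℕₚ.suc-injective len) degX
                 (trans (cong (ℕ._+ c) (trans (cong (ℕ._+ j) (∣add∣ Y e eY)) (sym (ℕₚ.+-suc ∣ Y ∣ j)))) degY))

  quadratic : Config m → (Idx → ℤ) → (Idx → ℤ) → ℤ
  quadratic X = ⟪_⟫ idxs (λ i j → τ a (i ∷ j ∷ []) X)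

  linearPart : Config m → (Idx → ℤ) → ℤ
  linearPart X u = ∑ idxs (λ i → τ a (i ∷ []) X * u i)

  quadratic-0 : ∀ X → ∣ X ∣ ≢ a → ∀ u v → quadratic X u v ≡ 0ℤ
  quadratic-0 X ≢a u v = ∑-0 idxs (λ i → ∑-0 idxs (λ j →
    cong (_* (u i * v j)) (τ-degree-a (i ∷ j ∷ []) X (λ eq → ≢a (ℕₚ.+-cancelʳ-≡ 2 _ _ (trans eq (ℕₚ.+-comm 2 a)))))))

  linearPart-0 : ∀ X → ∣ X ∣ ≢ suc a → ∀ u → linearPart X u ≡ 0ℤ
  linearPart-0 X ≢1+a u = ∑-0 idxs (λ i →
    cong (_* u i) (τ-degree-a (i ∷ []) X (λ eq → ≢1+a (ℕₚ.+-cancelʳ-≡ 1 _ _ (trans eq (ℕₚ.+-comm 1 (suc a)))))))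

  constant-0 : ∀ X → ∣ X ∣ ≢ suc (suc a) → τ a [] X ≡ 0ℤ
  constant-0 X ≢2+a = τ-degree-a [] X (λ eq → ≢2+a (trans (sym (ℕₚ.+-identityʳ ∣ X ∣)) eq))

  ∑-vars : ∀ (f : Var → ℤ) → ∑ vars f ≡ ∑ idxs (f ∘ inj₁) + ∑ idxs (f ∘ inj₂)
  ∑-vars f = trans (∑-++ (map inj₁ idxs) (map inj₂ idxs) f) (cong₂ _+_ (∑-map inj₁ idxs f) (∑-map inj₂ idxs f))

  hessian : (X Y : Config m) → List (Fin m) → Var → Var → ℤ
  hessian X Y es i j = G (i ∷ j ∷ []) X Y es

  -- The product rule: two derivatives fall both on the left factor, one on each factor in either
  -- order, or both on the right factor.
  hessian-product : ∀ X Y u v → ⟪_⟫ vars (hessian X Y []) u v ≡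
    quadratic X (u ∘ inj₁) (v ∘ inj₁) * τ a [] Y + linearPart X (u ∘ inj₁) * linearPart Y (v ∘ inj₂)
    + (linearPart X (v ∘ inj₁) * linearPart Y (u ∘ inj₂) + quadratic Y (u ∘ inj₂) (v ∘ inj₂) * τ a [] X)
  hessian-product X Y u v = trans (∑-vars (λ i → ∑ vars (entry i))) (cong₂ _+_
      (trans (∑-cong idxs (λ i → ∑-vars (entry (inj₁ i)))) (trans (∑-+ idxs (half inj₁ inj₁) (half inj₁ inj₂)) (cong₂ _+_ blockˡˡ blockˡʳ)))
      (trans (∑-cong idxs (λ i → ∑-vars (entry (inj₂ i)))) (trans (∑-+ idxs (half inj₂ inj₁) (half inj₂ inj₂)) (cong₂ _+_ blockʳˡ blockʳʳ))))
    where
    entry : Var → Var → ℤ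
    entry i j = hessian X Y [] i j * (u i * v j)
    half : (Idx → Var) → (Idx → Var) → Idx → ℤ
    half φ ψ i = ∑ idxs (λ j → entry (φ i) (ψ j))
    rearrange₁ : ∀ p q r → p * q * r ≡ p * r * q
    rearrange₁ = solve-∀
    rearrange₂ : ∀ p q r s → p * q * (r * s) ≡ p * r * (q * s)
    rearrange₂ = solve-∀
    rearrange₃ : ∀ p q r s → p * q * (r * s) ≡ q * r * (p * s)
    rearrange₃ = solve-∀
    rearrange₄ : ∀ p q r → p * q * r ≡ q * r * p
    rearrange₄ = solve-∀
    blockˡˡ : ∑ idxs (λ i → ∑ idxs (λ j → τ a (i ∷ j ∷ []) X * τ a [] Y * (u (inj₁ i) * v (inj₁ j))))
              ≡ quadratic X (u ∘ inj₁) (v ∘ inj₁) * τ a [] Y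
    blockˡˡ = trans (∑-cong idxs (λ i → trans (∑-cong idxs (λ j → rearrange₁ (τ a (i ∷ j ∷ []) X) (τ a [] Y) (u (inj₁ i) * v (inj₁ j))))
      (∑-*ʳ idxs (λ j → τ a (i ∷ j ∷ []) X * (u (inj₁ i) * v (inj₁ j))) (τ a [] Y)))) (∑-*ʳ idxs (λ i → ∑ idxs (λ j → τ a (i ∷ j ∷ []) X * (u (inj₁ i) * v (inj₁ j)))) (τ a [] Y))
    blockˡʳ : ∑ idxs (λ i → ∑ idxs (λ j → τ a (i ∷ []) X * τ a (j ∷ []) Y * (u (inj₁ i) * v (inj₂ j))))
              ≡ linearPart X (u ∘ inj₁) * linearPart Y (v ∘ inj₂)
    blockˡʳ = trans (∑-cong idxs (λ i → ∑-cong idxs (λ j → rearrange₂ (τ a (i ∷ []) X) (τ a (j ∷ []) Y) (u (inj₁ i)) (v (inj₂ j)))))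
      (∑-product idxs idxs (λ i → τ a (i ∷ []) X * u (inj₁ i)) (λ j → τ a (j ∷ []) Y * v (inj₂ j)))
    blockʳˡ : ∑ idxs (λ i → ∑ idxs (λ j → τ a (j ∷ []) X * τ a (i ∷ []) Y * (u (inj₂ i) * v (inj₁ j))))
              ≡ linearPart X (v ∘ inj₁) * linearPart Y (u ∘ inj₂)
    blockʳˡ = trans (∑-cong idxs (λ i → ∑-cong idxs (λ j → rearrange₃ (τ a (j ∷ []) X) (τ a (i ∷ []) Y) (u (inj₂ i)) (v (inj₁ j)))))
      (trans (∑-product idxs idxs (λ i → τ a (i ∷ []) Y * u (inj₂ i)) (λ j → τ a (j ∷ []) X * v (inj₁ j))) (*-comm (linearPart Y (u ∘ inj₂)) (linearPart X (v ∘ inj₁))))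
    blockʳʳ : ∑ idxs (λ i → ∑ idxs (λ j → τ a [] X * τ a (i ∷ j ∷ []) Y * (u (inj₂ i) * v (inj₂ j))))
              ≡ quadratic Y (u ∘ inj₂) (v ∘ inj₂) * τ a [] X
    blockʳʳ = trans (∑-cong idxs (λ i → trans (∑-cong idxs (λ j → rearrange₄ (τ a [] X) (τ a (i ∷ j ∷ []) Y) (u (inj₂ i) * v (inj₂ j))))
      (∑-*ʳ idxs (λ j → τ a (i ∷ j ∷ []) Y * (u (inj₂ i) * v (inj₂ j))) (τ a [] X)))) (∑-*ʳ idxs (λ i → ∑ idxs (λ j → τ a (i ∷ j ∷ []) Y * (u (inj₂ i) * v (inj₂ j)))) (τ a [] X))

  open Basis (⊎.≡-dec (Fin._≟_ {suc m}) (Fin._≟_ {suc m}))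

  vars-unique : Unique vars
  vars-unique = Unique.++⁺ (Unique.map⁺ ⊎.inj₁-injective (Unique.allFin⁺ (suc m))) (Unique.map⁺ ⊎.inj₂-injective (Unique.allFin⁺ (suc m)))
    λ (i∈ˡ , i∈ʳ) → disjoint (∈-map⁻ inj₁ i∈ˡ) (∈-map⁻ inj₂ i∈ʳ)
    where
    disjoint : ∀ {i} → ∃[ j ] (j ∈ idxs × i ≡ inj₁ j) → ∃[ j ] (j ∈ idxs × i ≡ inj₂ j) → ⊥
    disjoint (_ , _ , refl) (_ , _ , ())

  vars-complete : ∀ i → i ∈ vars
  vars-complete (inj₁ i) = ∈-++⁺ˡ (∈-map⁺ inj₁ (∈-allFin i))
  vars-complete (inj₂ i) = ∈-++⁺ʳ (map inj₁ idxs) (∈-map⁺ inj₂ (∈-allFin i))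

  module _ (quadratic-lorentzian : ∀ X → ∣ X ∣ ≡ a → Lorentzian (quadratic X)) where

    -- The polynomial is a product of a factor of degree a + 2 - |X| in (s,x) and one of degree a +
    -- 2 - |Y| in (t,y). These numbers add up to two, so the relevant cases are (2,0), (1,1) and
    -- (0,2).
    hessian-[]-lorentzian : ∀ X Y → ∣ X ∣ ℕ.+ ∣ Y ∣ ≡ m → Lorentzian (⟪_⟫ vars (hessian X Y []))
    hessian-[]-lorentzian X Y total = go
      where
      qˣ qʸ : (Var → ℤ) → (Var → ℤ) → ℤ
      qˣ u v = quadratic X (u ∘ inj₁) (v ∘ inj₁)
      qʸ u v = quadratic Y (u ∘ inj₂) (v ∘ inj₂)
      lˣ lʸ : (Var → ℤ) → ℤ
      lˣ u = linearPart X (u ∘ inj₁)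
      lʸ u = linearPart Y (u ∘ inj₂)
      cˣ cʸ : ℤ
      cˣ = τ a [] X
      cʸ = τ a [] Y
      only-q₁ : ∀ q₁ c₂ {l₁} l₂ {l₁′} l₂′ q₂ {c₁} → l₁ ≡ 0ℤ → l₁′ ≡ 0ℤ → c₁ ≡ 0ℤ → q₁ * c₂ + l₁ * l₂ + (l₁′ * l₂′ + q₂ * c₁) ≡ q₁ * c₂
      only-q₁ q₁ c₂ l₂ l₂′ q₂ refl refl refl = simplify (q₁ * c₂) l₂ l₂′ q₂
        where
        simplify : ∀ p q r s → p + 0ℤ * q + (0ℤ * r + s * 0ℤ) ≡ p
        simplify = solve-∀
      only-l : ∀ q₁ {c₂} l₁ l₂ l₁′ l₂′ q₂ {c₁} → c₂ ≡ 0ℤ → c₁ ≡ 0ℤ → q₁ * c₂ + l₁ * l₂ + (l₁′ * l₂′ + q₂ * c₁) ≡ l₁ * l₂ + l₁′ * l₂′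
      only-l q₁ l₁ l₂ l₁′ l₂′ q₂ refl refl = simplify q₁ (l₁ * l₂) (l₁′ * l₂′) q₂
        where
        simplify : ∀ p q r s → p * 0ℤ + q + (r + s * 0ℤ) ≡ q + r
        simplify = solve-∀
      only-q₂ : ∀ {q₁} c₂ {l₁} l₂ {l₁′} l₂′ q₂ c₁ → q₁ ≡ 0ℤ → l₁ ≡ 0ℤ → l₁′ ≡ 0ℤ → q₁ * c₂ + l₁ * l₂ + (l₁′ * l₂′ + q₂ * c₁) ≡ q₂ * c₁
      only-q₂ c₂ l₂ l₂′ q₂ c₁ refl refl refl = simplify c₂ l₂ l₂′ (q₂ * c₁)
        where
        simplify : ∀ p q r s → 0ℤ * p + 0ℤ * q + (0ℤ * r + s) ≡ s
        simplify = solve-∀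
      go : Lorentzian (⟪_⟫ vars (hessian X Y []))
      go with ∣ X ∣ ℕₚ.≟ a
      ... | yes x≡a = lorentzian-cong {A = λ u v → qˣ u v * cʸ} {B = ⟪_⟫ vars (hessian X Y [])}
              (λ u v → sym (trans (hessian-product X Y u v) (only-q₁ (qˣ u v) cʸ {lˣ u} (lʸ v) {lˣ v} (lʸ u) (qʸ u v) {cˣ}
                (linearPart-0 X x≢1+a (u ∘ inj₁)) (linearPart-0 X x≢1+a (v ∘ inj₁)) (constant-0 X x≢2+a))))
              (lorentzian-scale inj₁ {A = quadratic X} {c = cʸ} (τ-nonNeg a [] Y) (quadratic-lorentzian X x≡a))
        where
        x≢1+a : ∣ X ∣ ≢ suc a
        x≢1+a eq = ℕₚ.1+n≢n (trans (sym eq) x≡a)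
        x≢2+a : ∣ X ∣ ≢ suc (suc a)
        x≢2+a eq = ℕₚ.m≢1+n+m a {1} (trans (sym x≡a) eq)
      ... | no x≢a with ∣ X ∣ ℕₚ.≟ suc a
      ...   | yes x≡1+a = lorentzian-cong {A = λ u v → lˣ u * lʸ v + lˣ v * lʸ u} {B = ⟪_⟫ vars (hessian X Y [])}
                (λ u v → sym (trans (hessian-product X Y u v) (only-l (qˣ u v) {cʸ} (lˣ u) (lʸ v) (lˣ v) (lʸ u) (qʸ u v) {cˣ}
                  (constant-0 Y (λ eq → ℕₚ.1+n≢n (trans (sym eq) y≡1+a))) (constant-0 X (λ eq → ℕₚ.1+n≢n (trans (sym eq) x≡1+a))))))
                (lorentzian-rank2 lˣ lʸ)
        where
        y≡1+a : ∣ Y ∣ ≡ suc a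
        y≡1+a = ℕₚ.+-cancelˡ-≡ (suc a) _ _ (trans (cong (ℕ._+ ∣ Y ∣) (sym x≡1+a)) (trans total m≡))
      -- Besides |X| = a + 2, where |Y| = a, this branch covers the sizes out of range; there |Y|
      -- differs from a and the quadratic part of Y is zero.
      ...   | no x≢1+a = lorentzian-cong {A = λ u v → qʸ u v * cˣ} {B = ⟪_⟫ vars (hessian X Y [])}
                (λ u v → sym (trans (hessian-product X Y u v) (only-q₂ {qˣ u v} cʸ {lˣ u} (lʸ v) {lˣ v} (lʸ u) (qʸ u v) cˣ
                  (quadratic-0 X x≢a (u ∘ inj₁) (v ∘ inj₁)) (linearPart-0 X x≢1+a (u ∘ inj₁)) (linearPart-0 X x≢1+a (v ∘ inj₁)))))
                (lorentzian-scale inj₂ {A = quadratic Y} {c = cˣ} (τ-nonNeg a [] X) qʸ-lorentzian)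
        where
        qʸ-lorentzian : Lorentzian (quadratic Y)
        qʸ-lorentzian with ∣ Y ∣ ℕₚ.≟ a
        ... | yes y≡a = quadratic-lorentzian Y y≡a
        ... | no y≢a = lorentzian-zero {A = quadratic Y} (quadratic-0 Y y≢a)

    -- Induction on the operators still to be applied, for all X and Y at once because each operator
    -- branches into two pairs. The condition on the total keeps the degree equal to two.
    hessian-lorentzian : ∀ es X Y → Fresh X Y es → Unique es → ∣ X ∣ ℕ.+ ∣ Y ∣ ℕ.+ length es ≡ m →
                         Lorentzian (⟪_⟫ vars (hessian X Y es))
    hessian-lorentzian [] X Y _ _ total = hessian-[]-lorentzian X Y (trans (sym (ℕₚ.+-identityʳ _)) total)
    hessian-lorentzian (e ∷ es) X Y ((eX , eY) ∷ fresh) (e≢es ∷ uniq) total =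
      lorentzian-cong {A = λ u v → A₁ u v + A₂ u v} {B = ⟪_⟫ vars (hessian X Y (e ∷ es))} (⟪⟫-+ vars T₁ T₂) sum-lorentzian
      where
      x y l : ℕ
      x = ∣ X ∣
      y = ∣ Y ∣
      l = length es
      T₁ T₂ : Var → Var → ℤ
      T₁ = hessian (add e X) Y es
      T₂ = hessian X (add e Y) es
      A₁ A₂ : (Var → ℤ) → (Var → ℤ) → ℤ
      A₁ = ⟪_⟫ vars T₁
      A₂ = ⟪_⟫ vars T₂
      form : ∀ X Y es → IsForm (⟪_⟫ vars (hessian X Y es))
      form X Y es = ⟪⟫-form vars (λ i j → splitSum-cong (F-swap i j) X Y es)
      total₁ : ∣ add e X ∣ ℕ.+ y ℕ.+ l ≡ m
      total₁ rewrite ∣add∣ X e eX = trans (sym (ℕₚ.+-suc (x ℕ.+ y) l)) total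
      total₂ : x ℕ.+ ∣ add e Y ∣ ℕ.+ l ≡ m
      total₂ rewrite ∣add∣ Y e eY = trans (trans (cong (ℕ._+ l) (ℕₚ.+-suc x y)) (sym (ℕₚ.+-suc (x ℕ.+ y) l))) total
      lor₁ : Lorentzian A₁
      lor₁ = hessian-lorentzian es (add e X) Y (fresh-addˡ X Y e≢es fresh) uniq total₁
      lor₂ : Lorentzian A₂
      lor₂ = hessian-lorentzian es X (add e Y) (fresh-addʳ X Y e≢es fresh) uniq total₂
      xᵉ yᵉ : Var
      xᵉ = inj₁ (suc e)
      yᵉ = inj₂ (suc e)
      row₁ : ∀ L → G (yᵉ ∷ L) (add e X) Y es ≡ G L (add e X) (add e Y) es
      row₁ L = G-addʳ L (add e X) Y eY e≢es
      row₂ : ∀ L → G (xᵉ ∷ L) X (add e Y) es ≡ G L (add e X) (add e Y) es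
      row₂ L = G-addˡ L X (add e Y) eX e≢es
      δδ : ∀ T i j → ⟪_⟫ vars T (δ i) (δ j) ≡ T i j
      δδ = ⟪⟫-δδ vars-unique vars-complete
      diagonal : ∀ X Y i → 0ℤ ≤ ⟪_⟫ vars (hessian X Y es) (δ i) (δ i)
      diagonal X Y i = ≤-trans (splitSum-nonNeg (F-nonNeg (i ∷ i ∷ [])) X Y es) (≤-reflexive (sym (δδ (hessian X Y es) i i)))
      sum-from-positive : ∀ z → 0ℤ < G (z ∷ []) (add e X) (add e Y) es →
                          Lorentzian (λ u v → A₁ u v + A₂ u v)
      sum-from-positive z 0<Gz = lorentzian-sum {A = A₁} {B = A₂} {x = δ xᵉ} {y = δ yᵉ} {z = δ z} (form (add e X) Y es) (form X (add e Y) es) lor₁ lor₂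
        (trans (δδ T₁ yᵉ yᵉ) (trans (row₁ (yᵉ ∷ [])) (G-absorbedʳ [] (add e X) (add e Y) (lookup∘update e Y true) e≢es)))
        (trans (δδ T₂ xᵉ xᵉ) (trans (row₂ (xᵉ ∷ [])) (G-absorbedˡ [] (add e X) (add e Y) (lookup∘update e X true) e≢es)))
        (λ v → trans (⟪⟫-δˡ vars-unique vars-complete T₁ yᵉ v)
          (trans (∑-cong vars (λ j → cong (_* v j) (trans (row₁ (j ∷ [])) (sym (row₂ (j ∷ []))))))
            (sym (⟪⟫-δˡ vars-unique vars-complete T₂ xᵉ v))))
        (subst (0ℤ <_) (sym (trans (δδ T₁ yᵉ z) (row₁ (z ∷ [])))) 0<Gz)
        (diagonal (add e X) Y z) (diagonal X (add e Y) z)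
      fresh₁₂ : Fresh (add e X) (add e Y) es
      fresh₁₂ = fresh-addˡ X (add e Y) e≢es (fresh-addʳ X Y e≢es fresh)
      l≡ : x ℕ.+ y ℕ.+ l ≡ suc (a ℕ.+ a)
      l≡ = ℕₚ.suc-injective (trans (sym (ℕₚ.+-suc (x ℕ.+ y) l)) (trans total (trans m≡ (cong suc (ℕₚ.+-suc a a)))))
      count : ∀ z b → ∣ add e z ∣ ≡ suc ∣ z ∣ → ∣ z ∣ ℕ.≤ b → ∀ c → suc b ℕ.+ c ≡ m → ∣ add e z ∣ ℕ.+ (b ∸ ∣ z ∣) ℕ.+ c ≡ m
      count z b add≡ z≤b c eq rewrite add≡ | ℕₚ.m+[n∸m]≡n z≤b = eq
      balance : ∀ b c → x ℕ.≤ b → y ℕ.≤ c → b ℕ.+ c ≡ suc (a ℕ.+ a) → l ≡ (b ∸ x) ℕ.+ (c ∸ y)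
      balance b c x≤b y≤c eq = ℕₚ.+-cancelˡ-≡ (x ℕ.+ y) _ _ (trans l≡ (trans (sym eq)
        (trans (cong₂ ℕ._+_ (sym (ℕₚ.m+[n∸m]≡n x≤b)) (sym (ℕₚ.m+[n∸m]≡n y≤c))) (interchange x (b ∸ x) y (c ∸ y)))))
        where
        interchange : ∀ p q r s → p ℕ.+ q ℕ.+ (r ℕ.+ s) ≡ p ℕ.+ r ℕ.+ (q ℕ.+ s)
        interchange = ℕ-Solver.solve-∀
      sum-lorentzian : Lorentzian (λ u v → A₁ u v + A₂ u v)
      -- If X or Y has more than a + 1 elements, adding e pushes that side above order m, so one of
      -- the two Hessians is zero and the other one decides. Otherwise the shared row has a positive
      -- entry.
      sum-lorentzian with x ℕₚ.≤? suc a | y ℕₚ.≤? suc a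
      ... | no x≰ | _ = lorentzian-cong {A = A₂} {B = λ u v → A₁ u v + A₂ u v} (λ u v → sym (trans (cong (_+ A₂ u v) (T₁≡0 u v)) (+-identityˡ _))) lor₂
        where
        T₁≡0 : ∀ u v → A₁ u v ≡ 0ℤ
        T₁≡0 u v = ∑-0 vars (λ i → ∑-0 vars (λ j → cong (_* (u i * v j))
          (G-highˡ (i ∷ j ∷ []) (add e X) Y es (subst (suc (suc a) ℕ.<_) (sym (∣add∣ X e eX)) (s≤s (ℕₚ.≰⇒> x≰))))))
      ... | yes _ | no y≰ = lorentzian-cong {A = A₁} {B = λ u v → A₁ u v + A₂ u v} (λ u v → sym (trans (cong (_+_ (A₁ u v)) (T₂≡0 u v)) (+-identityʳ _))) lor₁
        where
        T₂≡0 : ∀ u v → A₂ u v ≡ 0ℤ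
        T₂≡0 u v = ∑-0 vars (λ i → ∑-0 vars (λ j → cong (_* (u i * v j))
          (G-highʳ (i ∷ j ∷ []) X (add e Y) es (subst (suc (suc a) ℕ.<_) (sym (∣add∣ Y e eY)) (s≤s (ℕₚ.≰⇒> y≰))))))
      ... | yes x≤1+a | yes y≤1+a with x ℕₚ.≤? a
      -- The entry in direction s needs a split sending a - |X| elements to the left and a + 1 - |Y|
      -- to the right, hence |X| at most a. For |X| = a + 1 the direction t is taken instead; then
      -- |Y| is at most a because |X| + |Y| is at most 2a + 1.
      ...   | yes x≤a = sum-from-positive (inj₁ zero)
                (splitSum-positive (suc a) a (a ∸ x) (suc a ∸ y) (add e X) (add e Y) es fresh₁₂ uniq
                  (balance a (suc a) x≤a y≤1+a (ℕₚ.+-suc a a))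
                  (count X a (∣add∣ X e eX) x≤a (suc a) (sym m≡))
                  (count Y (suc a) (∣add∣ Y e eY) y≤1+a a (trans (cong suc (sym (ℕₚ.+-suc a a))) (sym m≡))))
      ...   | no x≰a = sum-from-positive (inj₂ zero)
                (splitSum-positive a (suc a) (suc a ∸ x) (a ∸ y) (add e X) (add e Y) es fresh₁₂ uniq
                  (balance (suc a) a x≤1+a y≤a refl)
                  (count X (suc a) (∣add∣ X e eX) x≤1+a a (trans (cong suc (sym (ℕₚ.+-suc a a))) (sym m≡)))
                  (count Y a (∣add∣ Y e eY) y≤a (suc a) (sym m≡)))
        where
        y≤a : y ℕ.≤ a
        y≤a = ℕₚ.+-cancelˡ-≤ (suc a) y a (ℕₚ.≤-trans (ℕₚ.+-monoˡ-≤ y (ℕₚ.≰⇒> x≰a))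
          (ℕₚ.≤-trans (ℕₚ.m≤m+n (x ℕ.+ y) l) (ℕₚ.≤-reflexive l≡)))

-- Rank weights and the parallel classes of a contraction.

∑-allFin-suc : ∀ {n} (f : Fin (suc n) → ℤ) → ∑ (allFin (suc n)) f ≡ f zero + ∑ (allFin n) (f ∘ suc)
∑-allFin-suc {n} f = cong (_+_ (f zero)) (trans (cong (λ is → ∑ is f) (sym (map-tabulate id suc))) (∑-map suc (allFin n) f))

module _ {A : Set} where

  firstOr : {P : A → Set} → Decidable P → A → List A → A
  firstOr P? d []       = d
  firstOr P? d (x ∷ xs) with P? x
  ... | yes _ = x
  ... | no _  = firstOr P? d xs

  firstOr-satisfies : {P : A → Set} (P? : Decidable P) → ∀ d {xs y} → y ∈ xs → P y → P (firstOr P? d xs)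
  firstOr-satisfies P? d {x ∷ xs} y∈ Py with P? x
  ... | yes Px = Px
  firstOr-satisfies P? d {x ∷ xs} (here refl) Py | no ¬Px = ⊥-elim (¬Px Py)
  firstOr-satisfies P? d {x ∷ xs} (there y∈) Py  | no ¬Px = firstOr-satisfies P? d y∈ Py

  -- Equivalent predicates have the same first hit. This is what makes `label` constant on parallel
  -- classes.
  firstOr-cong : {P Q : A → Set} (P? : Decidable P) (Q? : Decidable Q) → (∀ {x} → P x → Q x) → (∀ {x} → Q x → P x) →
                 ∀ d d′ {xs y} → y ∈ xs → P y → firstOr P? d xs ≡ firstOr Q? d′ xs
  firstOr-cong P? Q? P⇒Q Q⇒P d d′ {x ∷ xs} y∈ Py with P? x | Q? x
  ... | yes _  | yes _  = refl
  ... | yes Px | no ¬Qx = ⊥-elim (¬Qx (P⇒Q Px))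
  ... | no ¬Px | yes Qx = ⊥-elim (¬Px (Q⇒P Qx))
  firstOr-cong P? Q? P⇒Q Q⇒P d d′ {x ∷ xs} (here refl) Py | no ¬Px | no _ = ⊥-elim (¬Px Py)
  firstOr-cong P? Q? P⇒Q Q⇒P d d′ {x ∷ xs} (there y∈) Py  | no ¬Px | no _ = firstOr-cong P? Q? P⇒Q Q⇒P d d′ y∈ Py

add-comm : ∀ {n} (X : Config n) e f → add f (add e X) ≡ add e (add f X)
add-comm X e f with e Fin.≟ f
... | yes refl = refl
... | no e≢f = []≔-commutes X e f e≢f

add-idem : ∀ {n} (X : Config n) e → add e (add e X) ≡ add e X
add-idem (x ∷ X) zero    = refl
add-idem (x ∷ X) (suc e) = cong (x ∷_) (add-idem X e)

-- `local` says that an element spanned by X stays spanned after f is added, a local form of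
-- submodularity. The value at the empty set is left free, so that the rank of a minor may carry the
-- rank of the contracted set as an additive constant.
record IsRank {n} (r : Config n → ℕ) : Set where
  field
    increasing : ∀ X e → r X ℕ.≤ r (add e X)
    unit       : ∀ X e → r (add e X) ℕ.≤ suc (r X)
    local      : ∀ X e f → r (add e X) ≡ r X → r (add e (add f X)) ≡ r (add f X)

outside : ∀ {n} → Config n → Fin n → ℤ
outside X e = if lookup X e then 0ℤ else 1ℤ

∑-outside : ∀ {n} (X : Config n) → ∑ (allFin n) (λ e → outside X e * outside X e) + + ∣ X ∣ ≡ + n
∑-outside []          = refl
∑-outside {suc n} (x ∷ X) = trans (cong (_+ + ∣ x ∷ X ∣) (∑-allFin-suc (λ e → outside (x ∷ X) e * outside (x ∷ X) e))) (step x)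
  where
  step : ∀ x → outside (x ∷ X) zero * outside (x ∷ X) zero + ∑ (allFin n) (λ e → outside X e * outside X e) + + ∣ x ∷ X ∣ ≡ + suc n
  step true  = trans (shift (∑ (allFin n) (λ e → outside X e * outside X e)) (+ ∣ X ∣)) (cong (_+_ 1ℤ) (∑-outside X))
    where
    shift : ∀ s t → 0ℤ + s + (1ℤ + t) ≡ 1ℤ + (s + t)
    shift = solve-∀
  step false = trans (shift (∑ (allFin n) (λ e → outside X e * outside X e)) (+ ∣ X ∣)) (cong (_+_ 1ℤ) (∑-outside X))
    where
    shift : ∀ s t → 1ℤ + s + t ≡ 1ℤ + (s + t)
    shift = solve-∀

module RankWeight {m : ℕ} (Q′ : ℕ) {r : Config m → ℕ} (isRank : IsRank r) where

  open IsRank isRank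
  open Basis (Fin._≟_ {m})

  q q′ : ℤ
  q = + suc Q′
  q′ = + Q′

  weight : Config m → ℤ
  weight X = + (suc Q′ ^ r X)

  weight-positive : ∀ X → 0ℤ < weight X
  weight-positive X = +<+ (ℕₚ.m^n>0 (suc Q′) (r X))

  weight-* : ∀ X Y → weight X * weight Y ≡ + (suc Q′ ^ (r X ℕ.+ r Y))
  weight-* X Y = trans (sym (pos-* (suc Q′ ^ r X) (suc Q′ ^ r Y))) (cong +_ (sym (ℕₚ.^-distribˡ-+-* (suc Q′) (r X) (r Y))))

  elems : List (Fin m)
  elems = allFin m

  module Contraction (X : Config m) where

    w : ℤ
    w = weight X

    c : Fin m → ℤ
    c e = if lookup X e then 0ℤ else weight (add e X)

    c₂ : Fin m → Fin m → ℤ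
    c₂ e f = if lookup X e then 0ℤ else (if lookup (add e X) f then 0ℤ else weight (add f (add e X)))

    -- Parallel nonloops of the contraction by X; the rank conditions force both elements to lie
    -- outside X. `_∥_` adds equality, so that a loop forms a class of its own.
    Parallel : Fin m → Fin m → Set
    Parallel e f = r (add e X) ≡ suc (r X) × r (add f X) ≡ suc (r X) × r (add f (add e X)) ≡ suc (r X)

    _∥_ : Fin m → Fin m → Set
    e ∥ f = e ≡ f ⊎ Parallel e f

    ∥-sym : ∀ {e f} → e ∥ f → f ∥ e
    ∥-sym (inj₁ refl) = inj₁ refl
    ∥-sym {e} {f} (inj₂ (re , rf , ref)) = inj₂ (rf , re , trans (cong r (sym (add-comm X e f))) ref)

    -- By `local`, adding e to X, f, g does not raise the rank, which is r(X) + 1 as f and g are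
    -- parallel. The rank of X, e, g lies between the rank of X, e and this one, and both are r(X) +
    -- 1.
    ∥-trans : ∀ {e f g} → e ∥ f → f ∥ g → e ∥ g
    ∥-trans (inj₁ refl) f∥g = f∥g
    ∥-trans e∥f (inj₁ refl) = e∥f
    ∥-trans {e} {f} {g} (inj₂ (re , rf , ref)) (inj₂ (_ , rg , rfg)) = inj₂ (re , rg , ℕₚ.≤-antisym upper lower)
      where
      rfeg : r (add f (add g (add e X))) ≡ suc (r X)
      rfeg = trans (cong r (trans (cong (add f) (add-comm X e g)) (trans (add-comm (add g X) e f) (cong (add e) (add-comm X g f)))))
        (trans (local (add f X) e g (trans (cong r (sym (add-comm X e f))) (trans ref (sym rf)))) rfg)
      upper : r (add g (add e X)) ℕ.≤ suc (r X)
      upper = ℕₚ.≤-trans (increasing (add g (add e X)) f) (ℕₚ.≤-reflexive rfeg)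
      lower : suc (r X) ℕ.≤ r (add g (add e X))
      lower = ℕₚ.≤-trans (ℕₚ.≤-reflexive (sym re)) (increasing (add e X) g)

    Peer : Fin m → Fin m → Set
    Peer e g = e ∥ g × lookup X g ≡ false

    peer? : ∀ e → Decidable (Peer e)
    peer? e g = ((e Fin.≟ g) ⊎-dec ((r (add e X) ℕₚ.≟ suc (r X)) ×-dec (r (add g X) ℕₚ.≟ suc (r X)) ×-dec (r (add g (add e X)) ℕₚ.≟ suc (r X))))
                ×-dec (lookup X g Bool.≟ false)

    -- A canonical representative outside X. Indexing classes by elements in this way allows their
    -- number to be compared with m - |X|.
    label : Fin m → Fin m
    label e = firstOr (peer? e) e elems

    label-peer : ∀ e → lookup X e ≡ false → Peer e (label e)
    label-peer e eX = firstOr-satisfies (peer? e) e (∈-allFin e) (inj₁ refl , eX)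

    ∥⇒label≡ : ∀ {e f} → lookup X e ≡ false → e ∥ f → label e ≡ label f
    ∥⇒label≡ {e} {f} eX e∥f = firstOr-cong (peer? e) (peer? f)
      (λ (e∥x , xX) → ∥-trans (∥-sym e∥f) e∥x , xX) (λ (f∥x , xX) → ∥-trans e∥f f∥x , xX) e f (∈-allFin e) (inj₁ refl , eX)

    label≡⇒∥ : ∀ {e f} → lookup X e ≡ false → lookup X f ≡ false → label e ≡ label f → e ∥ f
    label≡⇒∥ {e} {f} eX fX eq = ∥-trans (proj₁ (label-peer e eX)) (∥-sym (subst (f ∥_) (sym eq) (proj₁ (label-peer f fX))))

    -- Either e or f is a loop over X and stays one by `local`, or both are nonloops and together
    -- raise the rank by two. For distinct e, f outside X this yields w c₂(e,f) = c(e) c(f).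
    ∦-modular : ∀ {e f} → ¬ Parallel e f → r X ℕ.+ r (add f (add e X)) ≡ r (add e X) ℕ.+ r (add f X)
    ∦-modular {e} {f} e∦f with r (add e X) ℕₚ.≟ r X
    ... | yes loop-e = trans (cong (r X ℕ.+_) (trans (cong r (add-comm X e f)) (local X e f loop-e))) (cong (ℕ._+ r (add f X)) (sym loop-e))
    ... | no ¬loop-e with r (add f X) ℕₚ.≟ r X
    ...   | yes loop-f = trans (cong (r X ℕ.+_) (local X f e loop-f)) (trans (ℕₚ.+-comm (r X) (r (add e X))) (cong (r (add e X) ℕ.+_) (sym loop-f)))
    ...   | no ¬loop-f = trans (cong (r X ℕ.+_) ref) (trans (ℕₚ.+-suc (r X) (suc (r X))) (sym (cong₂ ℕ._+_ re rf)))
      where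
      nonloop : ∀ g → r (add g X) ≢ r X → r (add g X) ≡ suc (r X)
      nonloop g ¬loop = ℕₚ.≤-antisym (unit X g) (ℕₚ.≤∧≢⇒< (increasing X g) (¬loop ∘ sym))
      re : r (add e X) ≡ suc (r X)
      re = nonloop e ¬loop-e
      rf : r (add f X) ≡ suc (r X)
      rf = nonloop f ¬loop-f
      ref : r (add f (add e X)) ≡ suc (suc (r X))
      ref = ℕₚ.≤-antisym (ℕₚ.≤-trans (unit (add e X) f) (ℕₚ.≤-reflexive (cong suc re)))
        (ℕₚ.≤∧≢⇒< (ℕₚ.≤-trans (ℕₚ.≤-reflexive (sym re)) (increasing (add e X) f)) (λ eq → e∦f (re , rf , sym eq)))

    -- For distinct e, f outside X, w c₂(e,f) equals c(e) c(f), divided by q if e and f are parallel in the contraction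
    -- by X; the terms with δ also account for the vanishing diagonal of c₂.
    coefficient : ∀ e f → q * (w * c₂ e f) + (q′ * (δ (label f) (label e) * (c e * c f)) + δ e f * (c e * c f)) ≡ q * (c e * c f)
    coefficient e f with lookup X e in eX
    ... | true = vanish q w q′ (δ (label f) (label e)) (if lookup X f then 0ℤ else weight (add f X)) (δ e f)
      where
      vanish : ∀ q w q′ d t d′ → q * (w * 0ℤ) + (q′ * (d * (0ℤ * t)) + d′ * (0ℤ * t)) ≡ q * (0ℤ * t)
      vanish = solve-∀
    ... | false with e Fin.≟ f
    ...   | yes refl rewrite lookup∘update e X true | eX with label e Fin.≟ label e
    ...     | yes _ = identity q′ w (weight (add e X))
      where
      identity : ∀ q′ w t → (1ℤ + q′) * (w * 0ℤ) + (q′ * (1ℤ * (t * t)) + 1ℤ * (t * t)) ≡ (1ℤ + q′) * (t * t)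
      identity = solve-∀
    ...     | no ≢ = ⊥-elim (≢ refl)
    coefficient e f | false | no e≢f rewrite lookup∘update′ (e≢f ∘ sym) X true with lookup X f in fX
    ... | true = vanish q w q′ (δ (label f) (label e)) (weight (add e X))
      where
      vanish : ∀ q w q′ d t → q * (w * 0ℤ) + (q′ * (d * (t * 0ℤ)) + 0ℤ * (t * 0ℤ)) ≡ q * (t * 0ℤ)
      vanish = solve-∀
    ... | false with label f Fin.≟ label e
    ...   | yes eq = trans (cong (_+ (q′ * (1ℤ * (weight (add e X) * weight (add f X))) + 0ℤ * (weight (add e X) * weight (add f X)))) parallel)
                (identity q′ (weight (add e X) * weight (add f X)))
      where
      identity : ∀ q′ t → t + (q′ * (1ℤ * t) + 0ℤ * t) ≡ (1ℤ + q′) * t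
      identity = solve-∀
      ranks : Parallel e f → suc (r X ℕ.+ r (add f (add e X))) ≡ r (add e X) ℕ.+ r (add f X)
      ranks (re , rf , ref) rewrite re | rf | ref = refl
      parallel : q * (w * weight (add f (add e X))) ≡ weight (add e X) * weight (add f X)
      parallel with label≡⇒∥ eX fX (sym eq)
      ... | inj₁ e≡f = ⊥-elim (e≢f e≡f)
      ... | inj₂ e∥f = trans (cong (q *_) (weight-* X (add f (add e X)))) (trans (sym (pos-* (suc Q′) (suc Q′ ^ (r X ℕ.+ r (add f (add e X))))))
                         (trans (cong (λ k → + (suc Q′ ^ k)) (ranks e∥f)) (sym (weight-* (add e X) (add f X)))))
    ...   | no label≢ = trans (cong (λ t → q * t + (q′ * (0ℤ * (weight (add e X) * weight (add f X))) + 0ℤ * (weight (add e X) * weight (add f X)))) modular)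
                (identity q q′ (weight (add e X) * weight (add f X)))
      where
      identity : ∀ q q′ t → q * t + (q′ * (0ℤ * t) + 0ℤ * t) ≡ q * t
      identity = solve-∀
      modular : w * weight (add f (add e X)) ≡ weight (add e X) * weight (add f X)
      modular = trans (weight-* X (add f (add e X)))
        (trans (cong (λ k → + (suc Q′ ^ k)) (∦-modular (λ e∥f → label≢ (sym (∥⇒label≡ eX (inj₂ e∥f)))))) (sym (weight-* (add e X) (add f X))))

    module _ (u : Fin m → ℤ) where

      p : Fin m → ℤ
      p e = c e * u e

      S E₂ D K N : ℤ
      S = ∑ elems p
      E₂ = ∑ elems (λ e → ∑ elems (λ f → c₂ e f * (u e * u f)))
      D = ∑ elems (λ e → p e * p e)
      K = ∑ elems (λ e → ∑ elems (λ f → δ (label f) (label e) * (p e * p f)))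
      N = ∑ elems (λ e → outside X e * outside X e)

      class : Fin m → ℤ
      class g = ∑ elems (λ e → δ (label e) g * p e)

      elems-δ : ∀ e f → ∑ elems (λ i → δ e i * f i) ≡ f e
      elems-δ e = ∑-δ (Unique.allFin⁺ m) (∈-allFin e)

      K-classes : K ≡ ∑ elems (λ g → class g * class g)
      K-classes = sym (begin
        ∑ elems (λ g → class g * class g)
          ≡⟨ ∑-cong elems (λ g → sym (∑-product elems elems (λ e → δ (label e) g * p e) (λ f → δ (label f) g * p f))) ⟩
        ∑ elems (λ g → ∑ elems (λ e → ∑ elems (λ f → t g e f)))
          ≡⟨ ∑-swap elems elems (λ g e → ∑ elems (t g e)) ⟩
        ∑ elems (λ e → ∑ elems (λ g → ∑ elems (λ f → t g e f)))
          ≡⟨ ∑-cong elems (λ e → ∑-swap elems elems (λ g f → t g e f)) ⟩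
        ∑ elems (λ e → ∑ elems (λ f → ∑ elems (λ g → t g e f)))
          ≡⟨ ∑-cong elems (λ e → ∑-cong elems (λ f → trans
              (∑-cong elems (λ g → regroup (δ (label e) g) (p e) (δ (label f) g) (p f)))
              (elems-δ (label e) (λ g → δ (label f) g * (p e * p f))))) ⟩
        K ∎)
        where
        open ≡-Reasoning
        t : Fin m → Fin m → Fin m → ℤ
        t g e f = δ (label e) g * p e * (δ (label f) g * p f)
        regroup : ∀ a b c d → a * b * (c * d) ≡ a * (c * (b * d))
        regroup = solve-∀

      outside-p : ∀ e → outside X e * p e ≡ p e
      outside-p e with lookup X e
      ... | true  = refl
      ... | false = *-identityˡ _

      outside-label-p : ∀ e → outside X (label e) * p e ≡ p e
      outside-label-p e with lookup X e in eX
      ... | true  = *-zeroʳ (outside X (label e))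
      ... | false rewrite proj₂ (label-peer e eX) = *-identityˡ _

      -- The factor `outside X` changes nothing: labels of elements outside X lie outside X, and `p`
      -- vanishes on X. It is inserted so that Cauchy-Schwarz counts at most m - |X| classes.
      S-classes : ∑ elems (λ g → outside X g * class g) ≡ S
      S-classes = begin
        ∑ elems (λ g → outside X g * class g)
          ≡⟨ ∑-cong elems (λ g → sym (∑-*ˡ elems (outside X g) (λ e → δ (label e) g * p e))) ⟩
        ∑ elems (λ g → ∑ elems (λ e → outside X g * (δ (label e) g * p e)))
          ≡⟨ ∑-swap elems elems (λ g e → outside X g * (δ (label e) g * p e)) ⟩
        ∑ elems (λ e → ∑ elems (λ g → outside X g * (δ (label e) g * p e)))
          ≡⟨ ∑-cong elems (λ e → trans (∑-cong elems (λ g → regroup (outside X g) (δ (label e) g) (p e)))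
               (trans (elems-δ (label e) (λ g → outside X g * p e)) (outside-label-p e))) ⟩
        S ∎
        where
        open ≡-Reasoning
        regroup : ∀ a b c → a * (b * c) ≡ b * (a * c)
        regroup = solve-∀

      S²≤N*D : S * S ≤ N * D
      S²≤N*D = subst (λ s → s * s ≤ N * D) (∑-cong elems outside-p) (cauchy-schwarz elems (outside X) p)

      S²≤N*K : S * S ≤ N * K
      S²≤N*K = subst₂ _≤_ (cong (λ s → s * s) S-classes) (cong (N *_) (sym K-classes)) (cauchy-schwarz elems (outside X) class)

      E₂-expansion : q * (w * E₂) + (q′ * K + D) ≡ q * (S * S)
      E₂-expansion = begin
        q * (w * E₂) + (q′ * K + D)
          ≡⟨ cong₂ _+_ E₂-double (cong₂ _+_ K-double D-double) ⟨
        ∑∑ t₁ + (∑∑ t₂ + ∑∑ t₃)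
          ≡⟨ cong (_+_ (∑∑ t₁)) (∑∑-+ t₂ t₃) ⟨
        ∑∑ t₁ + ∑∑ (λ e f → t₂ e f + t₃ e f)
          ≡⟨ ∑∑-+ t₁ (λ e f → t₂ e f + t₃ e f) ⟨
        ∑∑ (λ e f → t₁ e f + (t₂ e f + t₃ e f))
          ≡⟨ ∑-cong elems (λ e → ∑-cong elems (λ f → pointwise e f)) ⟩
        ∑∑ (λ e f → q * (p e * p f))
          ≡⟨ trans (∑∑-*ˡ q (λ e f → p e * p f)) (cong (q *_) (∑-product elems elems p p)) ⟩
        q * (S * S) ∎
        where
        open ≡-Reasoning
        ∑∑ : (Fin m → Fin m → ℤ) → ℤ
        ∑∑ t = ∑ elems (λ e → ∑ elems (λ f → t e f))
        ∑∑-+ : ∀ s t → ∑∑ (λ e f → s e f + t e f) ≡ ∑∑ s + ∑∑ t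
        ∑∑-+ s t = trans (∑-cong elems (λ e → ∑-+ elems (s e) (t e))) (∑-+ elems (λ e → ∑ elems (s e)) (λ e → ∑ elems (t e)))
        ∑∑-*ˡ : ∀ k t → ∑∑ (λ e f → k * t e f) ≡ k * ∑∑ t
        ∑∑-*ˡ k t = trans (∑-cong elems (λ e → ∑-*ˡ elems k (t e))) (∑-*ˡ elems k (λ e → ∑ elems (t e)))
        t₁ t₂ t₃ : Fin m → Fin m → ℤ
        t₁ e f = q * (w * (c₂ e f * (u e * u f)))
        t₂ e f = q′ * (δ (label f) (label e) * (p e * p f))
        t₃ e f = δ e f * (p e * p f)
        pointwise : ∀ e f → t₁ e f + (t₂ e f + t₃ e f) ≡ q * (p e * p f)
        pointwise e f = trans (collect q w (c₂ e f) q′ (δ (label f) (label e)) (δ e f) (c e) (c f) (u e) (u f))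
          (trans (cong (_* (u e * u f)) (coefficient e f)) (distribute q (c e) (c f) (u e) (u f)))
          where
          collect : ∀ q w k q′ d d′ a b x y → q * (w * (k * (x * y))) + (q′ * (d * (a * x * (b * y))) + d′ * (a * x * (b * y)))
                    ≡ (q * (w * k) + (q′ * (d * (a * b)) + d′ * (a * b))) * (x * y)
          collect = solve-∀
          distribute : ∀ q a b x y → q * (a * b) * (x * y) ≡ q * (a * x * (b * y))
          distribute = solve-∀
        E₂-double : ∑∑ t₁ ≡ q * (w * E₂)
        E₂-double = trans (∑∑-*ˡ q (λ e f → w * (c₂ e f * (u e * u f)))) (cong (q *_) (∑∑-*ˡ w (λ e f → c₂ e f * (u e * u f))))
        K-double : ∑∑ t₂ ≡ q′ * K
        K-double = ∑∑-*ˡ q′ (λ e f → δ (label f) (label e) * (p e * p f))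
        D-double : ∑∑ t₃ ≡ D
        D-double = ∑-cong elems (λ e → elems-δ e (λ f → p e * p f))

      -- By `E₂-expansion`, q w E₂ = q S^2 - (q - 1) K - D, where K is the sum of squared class sums
      -- and D the sum of squared terms. There are at most N nonempty classes outside X and at most
      -- N nonzero terms, so N K and N D are both at least S^2 by Cauchy-Schwarz; their coefficients
      -- q - 1 and 1 are nonnegative.
      quadratic-bound : 0ℤ ≤ N → N * (w * E₂) ≤ (N - 1ℤ) * (S * S)
      quadratic-bound 0≤N = *-cancelˡ-≤-pos′ {q} (+<+ (s≤s z≤n)) (≤-gap
        (q′ * (N * K - S * S) + (N * D - S * S))
        (+-mono-≤ (*-nonNeg {q′} (+≤+ z≤n) (i≤j⇒0≤j-i S²≤N*K)) (i≤j⇒0≤j-i S²≤N*D))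
        (trans (regroup q′ N (w * E₂) K D (S * S)) (trans (cong (λ t → N * t - q * (S * S)) E₂-expansion) (finish q N (S * S)))))
        where
        regroup : ∀ q′ N x K D s → (1ℤ + q′) * (N * x) + (q′ * (N * K - s) + (N * D - s)) ≡ N * ((1ℤ + q′) * x + (q′ * K + D)) - (1ℤ + q′) * s
        regroup = solve-∀
        finish : ∀ q N s → N * (q * s) - q * s ≡ q * ((N - 1ℤ) * s)
        finish = solve-∀

-- Splits of the ground set as pairs of complementary sets.

complement : ∀ {n} → Config n → Config n
complement = Vec.map not

∣complement∣ : ∀ {n} (η : Config n) → ∣ η ∣ ℕ.+ ∣ complement η ∣ ≡ n
∣complement∣ []          = refl
∣complement∣ (true ∷ η)  = cong suc (∣complement∣ η)
∣complement∣ (false ∷ η) = trans (ℕₚ.+-suc ∣ η ∣ _) (cong suc (∣complement∣ η))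

∣emptySet∣ : ∀ n → ∣ emptySet n ∣ ≡ 0
∣emptySet∣ zero    = refl
∣emptySet∣ (suc n) = ∣emptySet∣ n

lookup-emptySet : ∀ {n} (e : Fin n) → lookup (emptySet n) e ≡ false
lookup-emptySet zero    = refl
lookup-emptySet (suc e) = lookup-emptySet e

splitSum-map-suc : ∀ {n} (g : Config (suc n) → Config (suc n) → ℤ) x y X Y es →
  splitSum g (x ∷ X) (y ∷ Y) (map suc es) ≡ splitSum (λ X Y → g (x ∷ X) (y ∷ Y)) X Y es
splitSum-map-suc g x y X Y []       = refl
splitSum-map-suc g x y X Y (e ∷ es) = cong₂ _+_ (splitSum-map-suc g x y (add e X) Y es) (splitSum-map-suc g x y X (add e Y) es)

splitSum-all : ∀ n (g : Config n → Config n → ℤ) →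
  splitSum g (emptySet n) (emptySet n) (allFin n) ≡ ∑ (allConfigs n) (λ η → g η (complement η))
splitSum-all zero    g = sym (+-identityʳ _)
splitSum-all (suc n) g = begin
  splitSum g (true ∷ ∅) (false ∷ ∅) (tabulate suc) + splitSum g (false ∷ ∅) (true ∷ ∅) (tabulate suc)
    ≡⟨ cong₂ _+_ (half true false) (half false true) ⟩
  ∑ (allConfigs n) (λ η → g (true ∷ η) (false ∷ complement η)) + ∑ (allConfigs n) (λ η → g (false ∷ η) (true ∷ complement η))
    ≡⟨ +-comm (∑ (allConfigs n) (λ η → g (true ∷ η) (false ∷ complement η))) _ ⟩
  ∑ (allConfigs n) (λ η → g (false ∷ η) (true ∷ complement η)) + ∑ (allConfigs n) (λ η → g (true ∷ η) (false ∷ complement η))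
    ≡⟨ cong₂ _+_ (∑-map (false ∷_) (allConfigs n) g′) (∑-map (true ∷_) (allConfigs n) g′) ⟨
  ∑ (map (false ∷_) (allConfigs n)) g′ + ∑ (map (true ∷_) (allConfigs n)) g′
    ≡⟨ ∑-++ (map (false ∷_) (allConfigs n)) (map (true ∷_) (allConfigs n)) g′ ⟨
  ∑ (allConfigs (suc n)) g′ ∎
  where
  open ≡-Reasoning
  ∅ = emptySet n
  g′ : Config (suc n) → ℤ
  g′ η = g η (complement η)
  half : ∀ x y → splitSum g (x ∷ ∅) (y ∷ ∅) (tabulate suc) ≡ ∑ (allConfigs n) (λ η → g (x ∷ η) (y ∷ complement η))
  half x y = trans (cong (splitSum g (x ∷ ∅) (y ∷ ∅)) (sym (map-tabulate id suc)))
    (trans (splitSum-map-suc g x y ∅ ∅ (allFin n)) (splitSum-all n (λ X Y → g (x ∷ X) (y ∷ Y))))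

splitSum-flip : ∀ {n} (g : Config n → Config n → ℤ) X Y es → splitSum g X Y es ≡ splitSum (λ Y X → g X Y) Y X es
splitSum-flip g X Y []       = refl
splitSum-flip g X Y (e ∷ es) = trans (cong₂ _+_ (splitSum-flip g (add e X) Y es) (splitSum-flip g X (add e Y) es))
  (+-comm (splitSum (λ Y X → g X Y) Y (add e X) es) _)

∑-filter : ∀ {I : Set} {P : I → Set} (P? : Decidable P) is (f : I → ℤ) →
           ∑ (filter P? is) f ≡ ∑ is (λ i → if ⌊ P? i ⌋ then f i else 0ℤ)
∑-filter P? []       f = refl
∑-filter P? (i ∷ is) f with P? i
... | yes _ = cong (_+_ (f i)) (∑-filter P? is f)
... | no _  = trans (∑-filter P? is f) (sym (+-identityˡ _))

layer : ∀ n → ℕ → List (Config n)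
layer n i = filter (λ η → ∣ η ∣ ℕₚ.≟ i) (allConfigs n)

square-cancel-≤ : ∀ {i j} → 0ℤ ≤ j → i * i ≤ j * j → i ≤ j
square-cancel-≤ {i} {j} 0≤j i²≤j² with i ≤? j
... | yes i≤j = i≤j
... | no i≰j = ⊥-elim (<⇒≱ j²<i² i²≤j²)
  where
  j<i : j < i
  j<i = ≰⇒> i≰j
  j²<i² : j * j < i * i
  j²<i² = ≤-<-trans (*-monoˡ-≤-nonNeg j {{ℤ.nonNegative 0≤j}} (<⇒≤ j<i))
    (*-monoʳ-<-pos i {{ℤ.positive (≤-<-trans 0≤j j<i)}} j<i)

-- The inequality for pairs weighted by rank.

module _ (m a : ℕ) (m≡ : m ≡ suc a ℕ.+ suc a) (Q′ : ℕ) {r : Config m → ℕ} (isRank : IsRank r) where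

  open RankWeight Q′ isRank
  open Bipartitions m a m≡ weight weight-positive

  -- Here k = a + 2 = m - |X|, and h is the row of s in the Hessian divided by (k - 1)!. The Hessian
  -- is a! R, and completing the square gives k w R = (k - 1) h^2 - ((k - 1) S^2 - k w E₂). The
  -- bracket is nonnegative by `quadratic-bound` with N = k.
  quadratic-lorentzian : ∀ X → ∣ X ∣ ≡ a → Lorentzian (quadratic X)
  quadratic-lorentzian X x≡a =
    nonPosOnKernel⇒lorentzian {h = h} {A = quadratic X} (⟪⟫-form idxs (λ i j → τ-swap a i j [] X)) h-linear nonPos
    where
    open Contraction X using (c; c₂; w)
    k : ℤ
    k = + suc (suc a)
    S E₂ : (Idx → ℤ) → ℤ
    S v = ∑ elems (λ e → c e * v (suc e))
    E₂ v = ∑ elems (λ e → ∑ elems (λ f → c₂ e f * (v (suc e) * v (suc f))))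
    h : (Idx → ℤ) → ℤ
    h v = k * w * v zero + S v
    h-linear : Linear h
    h-linear x u y v = trans (cong (_+_ (k * w * (x * u zero + y * v zero)))
        (trans (∑-cong elems (λ e → distribute (c e) x (u (suc e)) y (v (suc e))))
          (trans (∑-+ elems (λ e → x * (c e * u (suc e))) (λ e → y * (c e * v (suc e))))
            (cong₂ _+_ (∑-*ˡ elems x (λ e → c e * u (suc e))) (∑-*ˡ elems y (λ e → c e * v (suc e)))))))
      (regroup (k * w) x (u zero) y (v zero) (S u) (S v))
      where
      distribute : ∀ c x u y v → c * (x * u + y * v) ≡ x * (c * u) + y * (c * v)
      distribute = solve-∀
      regroup : ∀ k x u y v s t → k * (x * u + y * v) + (x * s + y * t) ≡ x * (k * u + s) + y * (k * v + t)
      regroup = solve-∀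
    total : ∀ b → ∣ X ∣ ℕ.+ (b ℕ.+ suc (suc a)) ≡ b ℕ.+ m
    total b rewrite x≡a | m≡ = shift a b
      where
      shift : ∀ a b → a ℕ.+ (b ℕ.+ suc (suc a)) ≡ b ℕ.+ (suc a ℕ.+ suc a)
      shift = ℕ-Solver.solve-∀
    τ₀₀ : τ a (zero ∷ zero ∷ []) X ≡ + (suc (suc a) !) * w
    τ₀₀ = τ-[] (suc (suc a)) X (total 0)
    τ₀ : ∀ e → τ a (zero ∷ suc e ∷ []) X ≡ + (suc a !) * c e
    τ₀ e with lookup X e in eX
    ... | true  = sym (*-zeroʳ (+ (suc a !)))
    ... | false = τ-[] (suc a) (add e X) (trans (cong (ℕ._+ suc a) (∣add∣ X e eX)) (trans (sym (ℕₚ.+-suc ∣ X ∣ (suc a))) (total 0)))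
    τ₁ : ∀ e f → τ a (suc e ∷ suc f ∷ []) X ≡ + (a !) * c₂ e f
    τ₁ e f with lookup X e in eX
    ... | true  = sym (*-zeroʳ (+ (a !)))
    ... | false with lookup (add e X) f in fX
    ...   | true  = sym (*-zeroʳ (+ (a !)))
    ...   | false = τ-[] a (add f (add e X)) (trans (cong (ℕ._+ a) (trans (∣add∣ (add e X) f fX) (cong suc (∣add∣ X e eX))))
                      (trans (shift ∣ X ∣ a) (total 0)))
      where
      shift : ∀ x a → suc (suc x) ℕ.+ a ≡ x ℕ.+ suc (suc a)
      shift = ℕ-Solver.solve-∀
    module _ (u : Idx → ℤ) where
      s R : ℤ
      s = u zero
      R = (k - 1ℤ) * k * (w * (s * s)) + (+ 2) * ((k - 1ℤ) * (s * S u)) + E₂ u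
      expansion : quadratic X u u ≡ + (a !) * R
      expansion = begin
        quadratic X u u
          ≡⟨ ∑-allFin-suc row ⟩
        row zero + ∑ elems (row ∘ suc)
          ≡⟨ cong₂ _+_ row-zero rows-suc ⟩
        (+ (suc (suc a) !) * w * (s * s) + + (suc a !) * s * S u) + (+ (suc a !) * s * S u + + (a !) * E₂ u)
          ≡⟨ cong₂ (λ x y → (x * w * (s * s) + y * s * S u) + (y * s * S u + + (a !) * E₂ u))
               (trans (pos-* (suc (suc a)) (suc a !)) (cong (k *_) (pos-* (suc a) (a !)))) (pos-* (suc a) (a !)) ⟩
        (k * (+ suc a * + (a !)) * w * (s * s) + + suc a * + (a !) * s * S u) + (+ suc a * + (a !) * s * S u + + (a !) * E₂ u)
          ≡⟨ regroup (+ suc a) (+ (a !)) w s (S u) (E₂ u) ⟩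
        + (a !) * R ∎
        where
        open ≡-Reasoning
        row : Idx → ℤ
        row i = ∑ idxs (λ j → τ a (i ∷ j ∷ []) X * (u i * u j))
        row-zero : row zero ≡ + (suc (suc a) !) * w * (s * s) + + (suc a !) * s * S u
        row-zero = trans (∑-allFin-suc (λ j → τ a (zero ∷ j ∷ []) X * (s * u j))) (cong₂ _+_ (cong (_* (s * s)) τ₀₀)
          (trans (∑-cong elems (λ e → trans (cong (_* (s * u (suc e))) (τ₀ e)) (move (+ (suc a !)) (c e) s (u (suc e)))))
            (∑-*ˡ elems (+ (suc a !) * s) (λ e → c e * u (suc e)))))
          where
          move : ∀ k c s u → k * c * (s * u) ≡ k * s * (c * u)
          move = solve-∀
        row-suc : ∀ e → row (suc e) ≡ + (suc a !) * s * (c e * u (suc e)) + + (a !) * ∑ elems (λ f → c₂ e f * (u (suc e) * u (suc f)))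
        row-suc e = trans (∑-allFin-suc (λ j → τ a (suc e ∷ j ∷ []) X * (u (suc e) * u j))) (cong₂ _+_
          (trans (cong (_* (u (suc e) * s)) (trans (τ-swap a (suc e) zero [] X) (τ₀ e))) (move (+ (suc a !)) (c e) s (u (suc e))))
          (trans (∑-cong elems (λ f → trans (cong (_* (u (suc e) * u (suc f))) (τ₁ e f)) (*-assoc (+ (a !)) (c₂ e f) (u (suc e) * u (suc f)))))
            (∑-*ˡ elems (+ (a !)) (λ f → c₂ e f * (u (suc e) * u (suc f))))))
          where
          move : ∀ k c s u → k * c * (u * s) ≡ k * s * (c * u)
          move = solve-∀
        rows-suc : ∑ elems (row ∘ suc) ≡ + (suc a !) * s * S u + + (a !) * E₂ u
        rows-suc = trans (∑-cong elems row-suc)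
          (trans (∑-+ elems (λ e → + (suc a !) * s * (c e * u (suc e))) (λ e → + (a !) * ∑ elems (λ f → c₂ e f * (u (suc e) * u (suc f)))))
            (cong₂ _+_ (∑-*ˡ elems (+ (suc a !) * s) (λ e → c e * u (suc e))) (∑-*ˡ elems (+ (a !)) (λ e → ∑ elems (λ f → c₂ e f * (u (suc e) * u (suc f)))))))
        regroup : ∀ b n w s S E → ((1ℤ + b) * (b * n) * w * (s * s) + b * n * s * S) + (b * n * s * S + n * E)
                  ≡ n * ((1ℤ + b - 1ℤ) * (1ℤ + b) * (w * (s * s)) + (+ 2) * ((1ℤ + b - 1ℤ) * (s * S)) + E)
        regroup = solve-∀
      bound : k * (w * E₂ u) ≤ (k - 1ℤ) * (S u * S u)
      bound = subst (λ N → N * (w * E₂ u) ≤ (N - 1ℤ) * (S u * S u)) N≡k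
        (Contraction.quadratic-bound X (u ∘ suc) (subst (0ℤ ≤_) (sym N≡k) (+≤+ z≤n)))
        where
        N≡k : ∑ elems (λ e → outside X e * outside X e) ≡ k
        N≡k = +-cancelʳ-≡ (+ ∣ X ∣) _ _ (trans (∑-outside X)
          (cong +_ (trans (sym (total 0)) (ℕₚ.+-comm ∣ X ∣ (suc (suc a))))))
          where
          +-cancelʳ-≡ : ∀ k i j → i + k ≡ j + k → i ≡ j
          +-cancelʳ-≡ k i j eq = trans (sym (cancel i k)) (trans (cong (_- k) eq) (cancel j k))
            where
            cancel : ∀ i k → i + k - k ≡ i
            cancel = solve-∀
    nonPos : ∀ u → h u ≡ 0ℤ → quadratic X u u ≤ 0ℤ
    nonPos u hu≡0 = ≤-trans (≤-reflexive (expansion u)) (*-nonPosʳ {+ (a !)} (+≤+ z≤n) R≤0)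
      where
      kw>0 : 0ℤ < k * w
      kw>0 = *-positive {k} (+<+ (s≤s z≤n)) (weight-positive X)
      R≤0 : R u ≤ 0ℤ
      R≤0 = *-cancelˡ-≤-pos′ {k * w} kw>0 (≤-gap
        ((k - 1ℤ) * (S u * S u) - k * (w * E₂ u)) (i≤j⇒0≤j-i (bound u))
        (trans (identity k w (u zero) (S u) (E₂ u)) (trans (cong (λ t → (k - 1ℤ) * (t * t)) hu≡0) (vanish k (k * w)))))
        where
        identity : ∀ k w s S E → k * w * ((k - 1ℤ) * k * (w * (s * s)) + (+ 2) * ((k - 1ℤ) * (s * S)) + E) + ((k - 1ℤ) * (S * S) - k * (w * E))
                   ≡ (k - 1ℤ) * ((k * w * s + S) * (k * w * s + S))
        identity = solve-∀
        vanish : ∀ k x → (k - 1ℤ) * (0ℤ * 0ℤ) ≡ x * 0ℤ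
        vanish = solve-∀

  pairWeight : Config m → ℤ
  pairWeight η = weight η * weight (complement η)

  τ-pair : ∀ i b → b ℕ.+ i ≡ m → ∀ η →
           τ b [] η * τ i [] (complement η) ≡ + (b !) * + (i !) * (if ⌊ ∣ η ∣ ℕₚ.≟ i ⌋ then pairWeight η else 0ℤ)
  τ-pair i b b+i≡m η with ∣ η ∣ ℕₚ.≟ i
  ... | yes η≡i = trans (cong₂ _*_ (τ-[] b η η+b≡m) (τ-[] i (complement η) η′+i≡m)) (regroup (+ (b !)) (weight η) (+ (i !)) (weight (complement η)))
    where
    η+b≡m : ∣ η ∣ ℕ.+ b ≡ m
    η+b≡m = trans (cong (ℕ._+ b) η≡i) (trans (ℕₚ.+-comm i b) b+i≡m)
    η′+i≡m : ∣ complement η ∣ ℕ.+ i ≡ m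
    η′+i≡m = trans (cong (∣ complement η ∣ ℕ.+_) (sym η≡i)) (trans (ℕₚ.+-comm ∣ complement η ∣ ∣ η ∣) (∣complement∣ η))
    regroup : ∀ b x i y → b * x * (i * y) ≡ b * i * (x * y)
    regroup = solve-∀
  ... | no η≢i = trans (cong (_* τ i [] (complement η)) (τ-degree b [] η (λ eq → η≢i (ℕₚ.+-cancelʳ-≡ b _ _
      (trans (trans (sym (ℕₚ.+-identityʳ _)) eq) (trans (sym b+i≡m) (ℕₚ.+-comm b i)))))))
    (sym (*-zeroʳ (+ (b !) * + (i !))))

  ∑-τ-pair : ∀ i b → b ℕ.+ i ≡ m →
    splitSum (λ X Y → τ b [] X * τ i [] Y) (emptySet m) (emptySet m) (allFin m) ≡ + (b !) * + (i !) * ∑ (layer m i) pairWeight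
  ∑-τ-pair i b b+i≡m = trans (splitSum-all m _) (trans (∑-cong (allConfigs m) (τ-pair i b b+i≡m))
    (trans (∑-*ˡ (allConfigs m) (+ (b !) * + (i !)) _) (cong (+ (b !) * + (i !) *_) (sym (∑-filter (λ η → ∣ η ∣ ℕₚ.≟ i) (allConfigs m) pairWeight)))))

  -- Only the block of s and t in the Hessian matters. Its entry at (s,s) is (a+2)! a! Z₀, its entry
  -- at (s,t) is (a+1)!^2 Z₁, and (t,t) agrees with (s,s) because exchanging the two sides of a
  -- split swaps s and t. The reverse Cauchy-Schwarz inequality thus compares two squares; after
  -- taking roots, the common factor (a+1)! a! is cancelled.
  weighted-antipodal-inequality : + suc (suc a) * ∑ (layer m a) pairWeight ≤ + suc a * ∑ (layer m (suc a)) pairWeight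
  weighted-antipodal-inequality = *-cancelˡ-≤-pos′ {+ (suc a !) * + (a !)} positive
    (subst₂ _≤_ (trans (∑-τ-pair a (suc (suc a)) (trans (cong suc (sym (ℕₚ.+-suc a a))) (sym m≡))) lhs)
                (trans (∑-τ-pair (suc a) (suc a) (sym m≡)) rhs) Ass≤Ast)
    where
    open Basis (⊎.≡-dec (Fin._≟_ {suc m}) (Fin._≟_ {suc m})) renaming (δ to δᵛ; ⟪⟫-δδ to ⟪⟫-δδᵛ)
    Z₀ Z₁ : ℤ
    Z₀ = ∑ (layer m a) pairWeight
    Z₁ = ∑ (layer m (suc a)) pairWeight
    positive : 0ℤ < + (suc a !) * + (a !)
    positive = *-positive {+ (suc a !)} {+ (a !)} (+<+ (ℕₚ.n≢0⇒n>0 (ℕ.≢-nonZero⁻¹ (suc a !) {{suc a ℕₚ.!≢0}}))) (+<+ (ℕₚ.n≢0⇒n>0 (ℕ.≢-nonZero⁻¹ (a !) {{a ℕₚ.!≢0}})))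
    lhs : + (suc (suc a) !) * + (a !) * Z₀ ≡ + (suc a !) * + (a !) * (+ suc (suc a) * Z₀)
    lhs = trans (cong (λ x → x * + (a !) * Z₀) (pos-* (suc (suc a)) (suc a !))) (regroup (+ suc (suc a)) (+ (suc a !)) (+ (a !)) Z₀)
      where
      regroup : ∀ k x y z → k * x * y * z ≡ x * y * (k * z)
      regroup = solve-∀
    rhs : + (suc a !) * + (suc a !) * Z₁ ≡ + (suc a !) * + (a !) * (+ suc a * Z₁)
    rhs = trans (cong (λ x → + (suc a !) * x * Z₁) (pos-* (suc a) (a !))) (regroup (+ suc a) (+ (suc a !)) (+ (a !)) Z₁)
      where
      regroup : ∀ k x y z → x * (k * y) * z ≡ x * y * (k * z)
      regroup = solve-∀
    ∅ : Config m
    ∅ = emptySet m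
    sᵛ tᵛ : Var
    sᵛ = inj₁ zero
    tᵛ = inj₂ zero
    H : Var → Var → ℤ
    H = hessian ∅ ∅ (allFin m)
    lor : Lorentzian (⟪_⟫ vars H)
    lor = hessian-lorentzian quadratic-lorentzian (allFin m) ∅ ∅
      (All.universal (λ e → lookup-emptySet e , lookup-emptySet e) (allFin m)) (Unique.allFin⁺ m)
      (trans (cong (λ x → x ℕ.+ x ℕ.+ length (allFin m)) (∣emptySet∣ m)) (length-tabulate id))
    at : ∀ i j → ⟪_⟫ vars H (δᵛ i) (δᵛ j) ≡ H i j
    at = ⟪⟫-δδᵛ vars-unique vars-complete H
    Ass Att Ast : ℤ
    Ass = H sᵛ sᵛ
    Att = H tᵛ tᵛ
    Ast = H sᵛ tᵛ
    Att≡Ass : Att ≡ Ass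
    Att≡Ass = trans (splitSum-flip (F (tᵛ ∷ tᵛ ∷ [])) ∅ ∅ (allFin m))
      (splitSum-cong (λ X Y → *-comm (τ a [] Y) (τ (suc (suc a)) [] X)) ∅ ∅ (allFin m))
    0≤ : ∀ i j → 0ℤ ≤ H i j
    0≤ i j = splitSum-nonNeg (F-nonNeg (i ∷ j ∷ [])) ∅ ∅ (allFin m)
    Ass≤Ast : Ass ≤ Ast
    Ass≤Ast = square-cancel-≤ (0≤ sᵛ tᵛ) (subst₂ _≤_
      (trans (cong₂ _*_ (at sᵛ sᵛ) (at tᵛ tᵛ)) (cong (Ass *_) Att≡Ass)) (cong₂ _*_ (at sᵛ tᵛ) (at sᵛ tᵛ))
      (lor (δᵛ sᵛ) (δᵛ tᵛ) (subst (0ℤ ≤_) (sym (at tᵛ tᵛ)) (0≤ tᵛ tᵛ))))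

-- From weighted sums to counts of independent pairs.

indicator : Bool → ℤ
indicator b = if b then 1ℤ else 0ℤ

∑-const : ∀ {I : Set} (is : List I) c → ∑ is (λ _ → c) ≡ + length is * c
∑-const []       c = refl
∑-const (i ∷ is) c = trans (cong (_+_ c) (∑-const is c)) (trans (step c (+ length is)) (cong (_* c) (sym (pos-+ 1 (length is)))))
  where
  step : ∀ c l → c + l * c ≡ (1ℤ + l) * c
  step = solve-∀

module _ (m a : ℕ) (m≡ : m ≡ suc a ℕ.+ suc a) {r : Config m → ℕ} (isRank : IsRank r)
         (good : Config m → Bool) (top : ℕ)
         (good⇒≡top : ∀ η → good η ≡ true → r η ℕ.+ r (complement η) ≡ top)
         (bad⇒<top : ∀ η → good η ≡ false → r η ℕ.+ r (complement η) ℕ.< top) where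

  count : ℕ → ℤ
  count i = ∑ (layer m i) (indicator ∘ good)

  -- The weight q^r(η) q^r(1-η) equals q^top on good η and is at most q^(top-1) otherwise; compare for q large.
  antipodal-inequality : + suc (suc a) * count a ≤ + suc a * count (suc a)
  antipodal-inequality = i<suc[j]⇒i≤j (*-cancelˡ-<-nonNeg q (≤-<-trans
      (*-cancelˡ-≤-pos′ {P} 0<P chain) below))
    where
    i<suc[j]⇒i≤j : ∀ {i j} → i < 1ℤ + j → i ≤ j
    i<suc[j]⇒i≤j {i} {j} i<1+j = ≤-trans (i<j⇒i≤pred[j] i<1+j) (≤-reflexive (pred-suc j))
    L Q′ : ℕ
    L = length (layer m (suc a))
    -- `L` bounds the number of bad sets in layer a + 1, and each has weight at most q^(top-1). For
    -- q = 1 + (a + 1) L their total, multiplied by a + 1, stays below q^top, which is less than one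
    -- unit after division by q^top.
    Q′ = suc a ℕ.* L
    open RankWeight Q′ isRank using (q; weight-*)
    pw : Config m → ℤ
    pw = pairWeight m a m≡ Q′ isRank
    P : ℤ
    P = + (suc Q′ ^ top)
    0<P : 0ℤ < P
    0<P = +<+ (ℕₚ.m^n>0 (suc Q′) top)
    lower : ∀ η → P * indicator (good η) ≤ pw η
    lower η with good η in eq
    ... | true  = ≤-reflexive (trans (*-identityʳ P) (sym (trans (weight-* η (complement η)) (cong (λ k → + (suc Q′ ^ k)) (good⇒≡top η eq)))))
    ... | false = ≤-trans (≤-reflexive (*-zeroʳ P)) (≤-trans (+≤+ z≤n) (≤-reflexive (sym (weight-* η (complement η)))))
    upper : ∀ η → q * pw η ≤ q * P * indicator (good η) + P
    upper η with good η in eq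
    ... | true  = ≤-trans (≤-reflexive (cong (q *_) (trans (weight-* η (complement η)) (cong (λ k → + (suc Q′ ^ k)) (good⇒≡top η eq)))))
                    (≤-gap P (<⇒≤ 0<P) (step q P))
      where
      step : ∀ q P → q * P + P ≡ q * P * 1ℤ + P
      step = solve-∀
    ... | false = ≤-trans (≤-reflexive (trans (cong (q *_) (weight-* η (complement η))) (sym (pos-* (suc Q′) (suc Q′ ^ (r η ℕ.+ r (complement η)))))))
                    (≤-trans (+≤+ (ℕₚ.^-monoʳ-≤ (suc Q′) (bad⇒<top η eq))) (≤-reflexive (step q P)))
      where
      step : ∀ q P → P ≡ q * P * 0ℤ + P
      step = solve-∀
    Z : ℕ → ℤ
    Z i = ∑ (layer m i) pw
    Z-lower : P * count a ≤ Z a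
    Z-lower = ≤-trans (≤-reflexive (sym (∑-*ˡ (layer m a) P (indicator ∘ good)))) (∑-mono (layer m a) lower)
    Z-upper : q * Z (suc a) ≤ q * P * count (suc a) + + L * P
    Z-upper = ≤-trans (≤-reflexive (sym (∑-*ˡ (layer m (suc a)) q pw))) (≤-trans (∑-mono (layer m (suc a)) upper)
      (≤-reflexive (trans (∑-+ (layer m (suc a)) (λ η → q * P * indicator (good η)) (λ _ → P))
        (cong₂ _+_ (∑-*ˡ (layer m (suc a)) (q * P) (indicator ∘ good)) (∑-const (layer m (suc a)) P)))))
    k b : ℤ
    k = + suc (suc a)
    b = + suc a
    chain : P * (q * (k * count a)) ≤ P * (q * (b * count (suc a)) + b * + L)
    chain = begin
      P * (q * (k * count a))
        ≡⟨ move P q k (count a) ⟩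
      q * (k * (P * count a))
        ≤⟨ *-monoˡ-≤-nonNeg q (*-monoˡ-≤-nonNeg k Z-lower) ⟩
      q * (k * Z a)
        ≤⟨ *-monoˡ-≤-nonNeg q (weighted-antipodal-inequality m a m≡ Q′ isRank) ⟩
      q * (b * Z (suc a))
        ≡⟨ swap q b (Z (suc a)) ⟩
      b * (q * Z (suc a))
        ≤⟨ *-monoˡ-≤-nonNeg b Z-upper ⟩
      b * (q * P * count (suc a) + + L * P)
        ≡⟨ finish b q P (count (suc a)) (+ L) ⟩
      P * (q * (b * count (suc a)) + b * + L) ∎
      where
      open ≤-Reasoning
      move : ∀ P q k n → P * (q * (k * n)) ≡ q * (k * (P * n))
      move = solve-∀
      swap : ∀ q b z → q * (b * z) ≡ b * (q * z)
      swap = solve-∀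
      finish : ∀ b q P n l → b * (q * P * n + l * P) ≡ P * (q * (b * n) + b * l)
      finish = solve-∀
    below : q * (b * count (suc a)) + b * + L < q * (1ℤ + b * count (suc a))
    below = <-≤-trans (+-monoʳ-< (q * (b * count (suc a))) bL<q) (≤-reflexive (collect q (b * count (suc a))))
      where
      bL<q : b * + L < q
      bL<q = ≤-<-trans (≤-reflexive (sym (pos-* (suc a) L))) (+<+ (ℕₚ.n<1+n Q′))
      collect : ∀ q x → q * x + q ≡ q * (1ℤ + x)
      collect = solve-∀

-- Rank functions

∈-allConfigs : ∀ {n} (η : Config n) → η ∈ allConfigs n
∈-allConfigs []          = here refl
∈-allConfigs (false ∷ η) = ∈-++⁺ˡ (∈-map⁺ (false ∷_) (∈-allConfigs η))
∈-allConfigs {suc n} (true ∷ η) = ∈-++⁺ʳ (map (false ∷_) (allConfigs n)) (∈-map⁺ (true ∷_) (∈-allConfigs η))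

⊆-∣∣ : ∀ {n} (I J : Config n) → I ⊆ J → ∣ I ∣ ℕ.≤ ∣ J ∣
⊆-∣∣ []        []        _ = z≤n
⊆-∣∣ (true ∷ I)  (true ∷ J)  I⊆J = s≤s (⊆-∣∣ I J (I⊆J ∘ suc))
⊆-∣∣ (true ∷ I)  (false ∷ J) I⊆J = ⊥-elim (I⊆J zero tt)
⊆-∣∣ (false ∷ I) (true ∷ J)  I⊆J = ℕₚ.m≤n⇒m≤1+n (⊆-∣∣ I J (I⊆J ∘ suc))
⊆-∣∣ (false ∷ I) (false ∷ J) I⊆J = ⊆-∣∣ I J (I⊆J ∘ suc)

⊆∧∣∣≡⇒≡ : ∀ {n} (I J : Config n) → I ⊆ J → ∣ I ∣ ≡ ∣ J ∣ → I ≡ J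
⊆∧∣∣≡⇒≡ []        []        _   _  = refl
⊆∧∣∣≡⇒≡ (true ∷ I)  (true ∷ J)  I⊆J eq = cong (true ∷_) (⊆∧∣∣≡⇒≡ I J (I⊆J ∘ suc) (ℕₚ.suc-injective eq))
⊆∧∣∣≡⇒≡ (true ∷ I)  (false ∷ J) I⊆J eq = ⊥-elim (I⊆J zero tt)
⊆∧∣∣≡⇒≡ (false ∷ I) (true ∷ J)  I⊆J eq = ⊥-elim (ℕₚ.1+n≰n (ℕₚ.≤-trans (ℕₚ.≤-reflexive (sym eq)) (⊆-∣∣ I J (I⊆J ∘ suc))))
⊆∧∣∣≡⇒≡ (false ∷ I) (false ∷ J) I⊆J eq = cong (false ∷_) (⊆∧∣∣≡⇒≡ I J (I⊆J ∘ suc) eq)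

emptySet-⊆ : ∀ {n} (η : Config n) → emptySet n ⊆ η
emptySet-⊆ η i i∈ = ⊥-elim (subst T (lookup-emptySet i) i∈)

T-not⇒≡false : ∀ {b} → T (not b) → b ≡ false
T-not⇒≡false {false} _ = refl

∈-add⁻ : ∀ {n} (X : Config n) {e g} → T (lookup (add e X) g) → g ≡ e ⊎ T (lookup X g)
∈-add⁻ X {e} {g} g∈ with g Fin.≟ e
... | yes g≡e = inj₁ g≡e
... | no g≢e  = inj₂ (subst T (lookup∘update′ g≢e X true) g∈)

∈-add : ∀ {n} (X : Config n) e → T (lookup (add e X) e)
∈-add X e = subst T (sym (lookup∘update e X true)) tt

⊆-add : ∀ {n} (X : Config n) e → X ⊆ add e X
⊆-add X e g g∈ with g Fin.≟ e
... | yes refl = ∈-add X e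
... | no g≢e   = subst T (sym (lookup∘update′ g≢e X true)) g∈

add-⊆ : ∀ {n} (X Y : Config n) {e} → X ⊆ Y → T (lookup Y e) → add e X ⊆ Y
add-⊆ X Y X⊆Y e∈Y g g∈ with ∈-add⁻ X g∈
... | inj₁ refl = e∈Y
... | inj₂ g∈X  = X⊆Y g g∈X

remove : ∀ {n} → Fin n → Config n → Config n
remove e X = X [ e ]≔ false

∣∣≤1+∣remove∣ : ∀ {n} (X : Config n) e → ∣ X ∣ ℕ.≤ suc ∣ remove e X ∣
∣∣≤1+∣remove∣ (true ∷ X)  zero    = ℕₚ.≤-refl
∣∣≤1+∣remove∣ (false ∷ X) zero    = ℕₚ.n≤1+n _
∣∣≤1+∣remove∣ (true ∷ X)  (suc e) = s≤s (∣∣≤1+∣remove∣ X e)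
∣∣≤1+∣remove∣ (false ∷ X) (suc e) = ∣∣≤1+∣remove∣ X e

∈-remove⁻ : ∀ {n} (X : Config n) {e g} → T (lookup (remove e X) g) → g ≢ e × T (lookup X g)
∈-remove⁻ X {e} {g} g∈ with g Fin.≟ e
... | yes refl = ⊥-elim (subst T (lookup∘update e X false) g∈)
... | no g≢e   = g≢e , subst T (lookup∘update′ g≢e X false) g∈

module MatroidRank {n} (M : Matroid n) where

  open Matroid M

  IndepSubset : Config n → Config n → Set
  IndepSubset X I = T (indep I) × I ⊆ X

  indepSubset? : ∀ X → Decidable (IndepSubset X)
  indepSubset? X I = T? (indep I) ×-dec all? (λ i → T? (lookup I i) →-dec T? (lookup X i))

  -- `argmax` takes a default; `emptySet n` is itself an independent subset of X, so the result is
  -- one in every case.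
  basis : Config n → Config n
  basis X = argmax ∣_∣ (emptySet n) (filter (indepSubset? X) (allConfigs n))

  rank : Config n → ℕ
  rank X = ∣ basis X ∣

  basis-indepSubset : ∀ X → IndepSubset X (basis X)
  basis-indepSubset X = argmax-all ∣_∣ (indep-∅ , emptySet-⊆ X) (all-filter (indepSubset? X) (allConfigs n))

  ∣∣≤rank : ∀ X I → IndepSubset X I → ∣ I ∣ ℕ.≤ rank X
  ∣∣≤rank X I I-sub = All.lookup (f[xs]≤f[argmax] (emptySet n) (filter (indepSubset? X) (allConfigs n)))
    (∈-filter⁺ (indepSubset? X) (∈-allConfigs I) I-sub)

  rank-indep : ∀ X → T (indep X) → rank X ≡ ∣ X ∣
  rank-indep X X-indep = ℕₚ.≤-antisym (⊆-∣∣ (basis X) X (proj₂ (basis-indepSubset X))) (∣∣≤rank X X (X-indep , λ _ → id))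

  rank-dep : ∀ X → ¬ T (indep X) → rank X ℕ.< ∣ X ∣
  rank-dep X X-dep = ℕₚ.≤∧≢⇒< (⊆-∣∣ (basis X) X (proj₂ (basis-indepSubset X)))
    (λ eq → X-dep (subst (T ∘ indep) (⊆∧∣∣≡⇒≡ (basis X) X (proj₂ (basis-indepSubset X)) eq) (proj₁ (basis-indepSubset X))))

  rank-increasing : ∀ X e → rank X ℕ.≤ rank (add e X)
  rank-increasing X e =
    ∣∣≤rank (add e X) (basis X) (proj₁ (basis-indepSubset X) , λ i i∈ → ⊆-add X e i (proj₂ (basis-indepSubset X) i i∈))

  rank-unit : ∀ X e → rank (add e X) ℕ.≤ suc (rank X)
  rank-unit X e = ℕₚ.≤-trans (∣∣≤1+∣remove∣ J e) (s≤s (∣∣≤rank X (remove e J) (J-e-indep , J-e⊆X)))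
    where
    J : Config n
    J = basis (add e X)
    J-e-indep : T (indep (remove e J))
    J-e-indep = indep-⊆ (remove e J) J (λ i i∈ → proj₂ (∈-remove⁻ J i∈)) (proj₁ (basis-indepSubset (add e X)))
    J-e⊆X : remove e J ⊆ X
    J-e⊆X g g∈ with ∈-remove⁻ J g∈
    ... | g≢e , g∈J with ∈-add⁻ X (proj₂ (basis-indepSubset (add e X)) g g∈J)
    ...   | inj₁ g≡e = ⊥-elim (g≢e g≡e)
    ...   | inj₂ g∈X = g∈X

  -- A basis I of X is also maximal in X + e. If adding e to X + f raised the rank, I could be
  -- augmented twice from a basis J of X + f + e. The first new element must be f by maximality; the
  -- second, h, then lies in X + e, and I + h is independent as a subset of I + f + h, against
  -- maximality.
  rank-local : ∀ X e f → rank (add e X) ≡ rank X → rank (add e (add f X)) ≡ rank (add f X)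
  rank-local X e f rank-e≡ = ℕₚ.≤-antisym (ℕₚ.≮⇒≥ no-increase) (rank-increasing (add f X) e)
    where
    I J : Config n
    I = basis X
    J = basis (add e (add f X))
    I-indep : T (indep I)
    I-indep = proj₁ (basis-indepSubset X)
    I⊆X : I ⊆ X
    I⊆X = proj₂ (basis-indepSubset X)
    I⊆X+ : ∀ g → I ⊆ add g X
    I⊆X+ g i i∈ = ⊆-add X g i (I⊆X i i∈)
    J-indep : T (indep J)
    J-indep = proj₁ (basis-indepSubset (add e (add f X)))
    J⊆ : J ⊆ add e (add f X)
    J⊆ = proj₂ (basis-indepSubset (add e (add f X)))
    maximal : ∀ g → lookup I g ≡ false → T (lookup (add e X) g) → ¬ T (indep (add g I))
    maximal g g∉I g∈ indep-gI = ℕₚ.1+n≰n (subst₂ ℕ._≤_ (∣add∣ I g g∉I) rank-e≡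
      (∣∣≤rank (add e X) (add g I) (indep-gI , add-⊆ I (add e X) (I⊆X+ e) g∈)))
    locate : ∀ g → T (lookup J g) → g ≡ f ⊎ T (lookup (add e X) g)
    locate g g∈J with ∈-add⁻ (add f X) (J⊆ g g∈J)
    ... | inj₁ refl = inj₂ (∈-add X e)
    ... | inj₂ g∈fX with ∈-add⁻ X g∈fX
    ...   | inj₁ g≡f = inj₁ g≡f
    ...   | inj₂ g∈X = inj₂ (⊆-add X e g g∈X)
    no-increase : ¬ (rank (add f X) ℕ.< rank (add e (add f X)))
    no-increase lt with augment I J I-indep J-indep (ℕₚ.≤-<-trans (∣∣≤rank (add f X) I (I-indep , I⊆X+ f)) lt)
    ... | g , g∉I , g∈J , indep-gI with locate g g∈J
    ...   | inj₂ g∈eX = maximal g (T-not⇒≡false g∉I) g∈eX indep-gI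
    ...   | inj₁ refl with augment (add f I) J indep-gI J-indep
                            (ℕₚ.≤-<-trans (∣∣≤rank (add f X) (add f I) (indep-gI , add-⊆ I (add f X) (I⊆X+ f) (∈-add X f))) lt)
    ...     | h , h∉fI , h∈J , indep-hfI with locate h h∈J
    ...       | inj₁ refl = subst (T ∘ not) (lookup∘update f I true) h∉fI
    ...       | inj₂ h∈eX = maximal h h∉I h∈eX (indep-⊆ (add h I) (add h (add f I)) hI⊆ indep-hfI)
      where
      h∉I : lookup I h ≡ false
      h∉I with lookup I h in eq
      ... | false = refl
      ... | true = ⊥-elim (subst T (T-not⇒≡false h∉fI) (⊆-add I f h (subst T (sym eq) tt)))
      hI⊆ : add h I ⊆ add h (add f I)
      hI⊆ = add-⊆ I (add h (add f I)) (λ i i∈ → ⊆-add (add f I) h i (⊆-add I f i i∈)) (∈-add (add f I) h)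

-- Minors

fill : ∀ {n} (ρ : Partial n) → Config (freeCount ρ) → Config n
fill []            []      = []
fill (nothing ∷ ρ) (x ∷ η) = x ∷ fill ρ η
fill (just b ∷ ρ)  η       = b ∷ fill ρ η

freeIndex : ∀ {n} (ρ : Partial n) → Fin (freeCount ρ) → Fin n
freeIndex (nothing ∷ ρ) zero    = zero
freeIndex (nothing ∷ ρ) (suc e) = suc (freeIndex ρ e)
freeIndex (just _ ∷ ρ)  e       = suc (freeIndex ρ e)

fixedOnes : ∀ {n} → Partial n → ℕ
fixedOnes []               = 0
fixedOnes (nothing ∷ ρ)    = fixedOnes ρ
fixedOnes (just true ∷ ρ)  = suc (fixedOnes ρ)
fixedOnes (just false ∷ ρ) = fixedOnes ρ

fill-add : ∀ {n} (ρ : Partial n) e η → fill ρ (add e η) ≡ add (freeIndex ρ e) (fill ρ η)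
fill-add (nothing ∷ ρ) zero    (x ∷ η) = refl
fill-add (nothing ∷ ρ) (suc e) (x ∷ η) = cong (x ∷_) (fill-add ρ e η)
fill-add (just b ∷ ρ)  e       η       = cong (b ∷_) (fill-add ρ e η)

∣fill∣ : ∀ {n} (ρ : Partial n) η → ∣ fill ρ η ∣ ≡ ∣ η ∣ ℕ.+ fixedOnes ρ
∣fill∣ []               []          = refl
∣fill∣ (nothing ∷ ρ)    (true ∷ η)  = cong suc (∣fill∣ ρ η)
∣fill∣ (nothing ∷ ρ)    (false ∷ η) = ∣fill∣ ρ η
∣fill∣ (just true ∷ ρ)  η           = trans (cong suc (∣fill∣ ρ η)) (sym (ℕₚ.+-suc ∣ η ∣ (fixedOnes ρ)))
∣fill∣ (just false ∷ ρ) η           = ∣fill∣ ρ η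

freeWeight-fill : ∀ {n} (ρ : Partial n) η → freeWeight ρ (fill ρ η) ≡ ∣ η ∣
freeWeight-fill []            []          = refl
freeWeight-fill (nothing ∷ ρ) (true ∷ η)  = cong suc (freeWeight-fill ρ η)
freeWeight-fill (nothing ∷ ρ) (false ∷ η) = freeWeight-fill ρ η
freeWeight-fill (just _ ∷ ρ)  η           = freeWeight-fill ρ η

flipFree-fill : ∀ {n} (ρ : Partial n) η → flipFree ρ (fill ρ η) ≡ fill ρ (complement η)
flipFree-fill []            []      = refl
flipFree-fill (nothing ∷ ρ) (x ∷ η) = cong (not x ∷_) (flipFree-fill ρ η)
flipFree-fill (just b ∷ ρ)  η       = cong (b ∷_) (flipFree-fill ρ η)

filter-map : ∀ {A B : Set} {P : B → Set} (P? : Decidable P) (f : A → B) xs →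
             filter P? (map f xs) ≡ map f (filter (P? ∘ f) xs)
filter-map P? f []       = refl
filter-map P? f (x ∷ xs) with P? (f x)
... | yes _ = cong (f x ∷_) (filter-map P? f xs)
... | no _  = filter-map P? f xs

agrees? : ∀ {n} (ρ : Partial n) → Decidable (λ η → agrees ρ η ≡ true)
agrees? ρ η = agrees ρ η Bool.≟ true

-- An equality of lists, order included, so that filters and sums pass to the free coordinates
-- through `map`.
freeConfigs-fill : ∀ {n} (ρ : Partial n) → freeConfigs ρ ≡ map (fill ρ) (allConfigs (freeCount ρ))
freeConfigs-fill [] = refl
freeConfigs-fill {suc n} (nothing ∷ ρ) = begin
  filter P? (map (false ∷_) A ++ map (true ∷_) A)
    ≡⟨ filter-++ P? (map (false ∷_) A) (map (true ∷_) A) ⟩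
  filter P? (map (false ∷_) A) ++ filter P? (map (true ∷_) A)
    ≡⟨ cong₂ _++_ (half false) (half true) ⟩
  map (fill (nothing ∷ ρ)) (map (false ∷_) B) ++ map (fill (nothing ∷ ρ)) (map (true ∷_) B)
    ≡⟨ map-++ (fill (nothing ∷ ρ)) (map (false ∷_) B) (map (true ∷_) B) ⟨
  map (fill (nothing ∷ ρ)) (map (false ∷_) B ++ map (true ∷_) B) ∎
  where
  open ≡-Reasoning
  A = allConfigs n
  B = allConfigs (freeCount ρ)
  P? : Decidable (λ η → agrees (nothing ∷ ρ) η ≡ true)
  P? = agrees? (nothing ∷ ρ)
  half : ∀ x → filter P? (map (x ∷_) A) ≡ map (fill (nothing ∷ ρ)) (map (x ∷_) B)
  half x = trans (filter-map P? (x ∷_) A)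
    (trans (cong (map (x ∷_)) (freeConfigs-fill ρ)) (trans (sym (map-∘ B)) (map-∘ B)))
freeConfigs-fill {suc n} (just true ∷ ρ) = begin
  filter P? (map (false ∷_) A ++ map (true ∷_) A)
    ≡⟨ filter-++ P? (map (false ∷_) A) (map (true ∷_) A) ⟩
  filter P? (map (false ∷_) A) ++ filter P? (map (true ∷_) A)
    ≡⟨ cong₂ _++_ (trans (filter-map P? (false ∷_) A) (cong (map (false ∷_)) (filter-none _ (All.universal (λ _ ()) A)))) (filter-map P? (true ∷_) A) ⟩
  map (true ∷_) (freeConfigs ρ)
    ≡⟨ trans (cong (map (true ∷_)) (freeConfigs-fill ρ)) (sym (map-∘ (allConfigs (freeCount ρ)))) ⟩
  map (fill (just true ∷ ρ)) (allConfigs (freeCount ρ)) ∎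
  where
  open ≡-Reasoning
  A = allConfigs n
  P? : Decidable (λ η → agrees (just true ∷ ρ) η ≡ true)
  P? = agrees? (just true ∷ ρ)
freeConfigs-fill {suc n} (just false ∷ ρ) = begin
  filter P? (map (false ∷_) A ++ map (true ∷_) A)
    ≡⟨ filter-++ P? (map (false ∷_) A) (map (true ∷_) A) ⟩
  filter P? (map (false ∷_) A) ++ filter P? (map (true ∷_) A)
    ≡⟨ cong₂ _++_ (filter-map P? (false ∷_) A) (trans (filter-map P? (true ∷_) A) (cong (map (true ∷_)) (filter-none _ (All.universal (λ _ ()) A)))) ⟩
  map (false ∷_) (freeConfigs ρ) ++ []
    ≡⟨ ++-identityʳ _ ⟩
  map (false ∷_) (freeConfigs ρ)
    ≡⟨ trans (cong (map (false ∷_)) (freeConfigs-fill ρ)) (sym (map-∘ (allConfigs (freeCount ρ)))) ⟩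
  map (fill (just false ∷ ρ)) (allConfigs (freeCount ρ)) ∎
  where
  open ≡-Reasoning
  A = allConfigs n
  P? : Decidable (λ η → agrees (just false ∷ ρ) η ≡ true)
  P? = agrees? (just false ∷ ρ)

freeLayer-fill : ∀ {n} (ρ : Partial n) i →
  filter (λ η → freeWeight ρ η ℕₚ.≟ i) (freeConfigs ρ) ≡ map (fill ρ) (layer (freeCount ρ) i)
freeLayer-fill ρ i = trans (cong (filter (λ η → freeWeight ρ η ℕₚ.≟ i)) (freeConfigs-fill ρ))
  (trans (filter-map (λ η → freeWeight ρ η ℕₚ.≟ i) (fill ρ) (allConfigs (freeCount ρ)))
    (cong (map (fill ρ)) (filter-≐ _ _ ((λ {η} → trans (sym (freeWeight-fill ρ η))) , (λ {η} → trans (freeWeight-fill ρ η))) (allConfigs (freeCount ρ)))))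

module Minor {n} (M : Matroid n) (ρ : Partial n) where

  open Matroid M using (indep)
  open MatroidRank M

  m : ℕ
  m = freeCount ρ

  indepPair : Config m → Bool
  indepPair η = indep (fill ρ η) ∧ indep (fill ρ (complement η))

  -- Fixed ones are contracted and fixed zeros deleted. This is the rank in that minor plus a
  -- constant, the rank of the set of fixed ones.
  minorRank : Config m → ℕ
  minorRank η = rank (fill ρ η)

  minorRank-isRank : IsRank minorRank
  minorRank-isRank .IsRank.increasing X e rewrite fill-add ρ e X = rank-increasing (fill ρ X) (freeIndex ρ e)
  minorRank-isRank .IsRank.unit X e rewrite fill-add ρ e X = rank-unit (fill ρ X) (freeIndex ρ e)
  minorRank-isRank .IsRank.local X e f eq
    rewrite fill-add ρ e (add f X) | fill-add ρ f X | fill-add ρ e X = rank-local (fill ρ X) (freeIndex ρ e) (freeIndex ρ f) eq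

  -- The joint size of the two filled sets of a complementary pair, the same for every pair. Rank is
  -- at most size, with equality for independent sets only, so the rank sum reaches `top` exactly on
  -- independent pairs.
  top : ℕ
  top = m ℕ.+ (fixedOnes ρ ℕ.+ fixedOnes ρ)

  ∣fill∣-pair : ∀ η → ∣ fill ρ η ∣ ℕ.+ ∣ fill ρ (complement η) ∣ ≡ top
  ∣fill∣-pair η rewrite ∣fill∣ ρ η | ∣fill∣ ρ (complement η) =
    trans (interchange (∣ η ∣) (fixedOnes ρ) (∣ complement η ∣)) (cong (ℕ._+ (fixedOnes ρ ℕ.+ fixedOnes ρ)) (∣complement∣ η))
    where
    interchange : ∀ x o y → x ℕ.+ o ℕ.+ (y ℕ.+ o) ≡ x ℕ.+ y ℕ.+ (o ℕ.+ o)
    interchange = ℕ-Solver.solve-∀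

  rank≤∣∣ : ∀ X → rank X ℕ.≤ ∣ X ∣
  rank≤∣∣ X = ⊆-∣∣ (basis X) X (proj₂ (basis-indepSubset X))

  indepPair⇒≡top : ∀ η → indepPair η ≡ true → minorRank η ℕ.+ minorRank (complement η) ≡ top
  indepPair⇒≡top η eq with indep (fill ρ η) in eq₁ | indep (fill ρ (complement η)) in eq₂
  ... | true | true = trans (cong₂ ℕ._+_ (rank-indep (fill ρ η) (subst T (sym eq₁) tt)) (rank-indep (fill ρ (complement η)) (subst T (sym eq₂) tt)))
                        (∣fill∣-pair η)

  ¬indepPair⇒<top : ∀ η → indepPair η ≡ false → minorRank η ℕ.+ minorRank (complement η) ℕ.< top
  ¬indepPair⇒<top η eq with indep (fill ρ η) in eq₁ | indep (fill ρ (complement η)) in eq₂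
  ... | false | _     = ℕₚ.<-≤-trans (ℕₚ.+-mono-<-≤ (rank-dep (fill ρ η) (subst T eq₁)) (rank≤∣∣ (fill ρ (complement η)))) (ℕₚ.≤-reflexive (∣fill∣-pair η))
  ... | true  | false = ℕₚ.<-≤-trans (ℕₚ.+-mono-≤-< (rank≤∣∣ (fill ρ η)) (rank-dep (fill ρ (complement η)) (subst T eq₂))) (ℕₚ.≤-reflexive (∣fill∣-pair η))

  pairCount : ℕ → ℤ
  pairCount i = ∑ (layer m i) (indicator ∘ indepPair)

  pairCount-inequality : ∀ a → m ≡ suc a ℕ.+ suc a → + suc (suc a) * pairCount a ≤ + suc a * pairCount (suc a)
  pairCount-inequality a m≡ = antipodal-inequality m a m≡ minorRank-isRank indepPair top indepPair⇒≡top ¬indepPair⇒<top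

-- Binomial coefficients.

C-factorials : ∀ {n k} → k ℕ.≤ n → (n C k) ℕ.* (k ! ℕ.* (n ∸ k) !) ≡ n !
C-factorials {n} {k} k≤n = trans (cong (ℕ._* (k ! ℕ.* (n ∸ k) !)) (nCk≡n!/k![n-k]! k≤n)) (m/n*n≡m {{k ℕₚ.!* (n ∸ k) !≢0}} (k![n∸k]!∣n! k≤n))

C-positive : ∀ {n k} → k ℕ.≤ n → 0 ℕ.< n C k
C-positive {n} {k} k≤n = ℕₚ.n≢0⇒n>0 (λ eq → ℕ.≢-nonZero⁻¹ (n !) {{n ℕₚ.!≢0}} (trans (sym (C-factorials k≤n)) (cong (ℕ._* (k ! ℕ.* (n ∸ k) !)) eq)))

-- Both sides equal m! / ((a+1)! a!). This ratio of neighbouring binomial coefficients matches the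
-- factors a + 2 and a + 1 in the inequality of counts.
central-C : ∀ m a → m ≡ suc a ℕ.+ suc a → suc (suc a) ℕ.* (m C a) ≡ suc a ℕ.* (m C suc a)
central-C .(suc a ℕ.+ suc a) a refl = ℕₚ.*-cancelʳ-≡ _ _ (suc a ! ℕ.* a !) {{suc a ℕₚ.!* a !≢0}}
  (trans (regroup₀ (suc (suc a)) (m C a) (suc a !) (a !)) (trans (trans low (sym high)) (regroup₁ (suc a) (m C suc a) (suc a !) (a !))))
  where
  m : ℕ
  m = suc a ℕ.+ suc a
  m∸a : m ∸ a ≡ suc (suc a)
  m∸a = trans (cong (_∸ a) (cong suc (ℕₚ.+-comm a (suc a)))) (ℕₚ.m+n∸n≡m (suc (suc a)) a)
  low : (m C a) ℕ.* (a ! ℕ.* (suc (suc a) ℕ.* suc a !)) ≡ m !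
  low = trans (cong (λ k → (m C a) ℕ.* (a ! ℕ.* k !)) (sym m∸a)) (C-factorials (ℕₚ.≤-trans (ℕₚ.n≤1+n a) (ℕₚ.m≤m+n (suc a) (suc a))))
  high : (m C suc a) ℕ.* (suc a ! ℕ.* (suc a ℕ.* a !)) ≡ m !
  high = trans (cong (λ k → (m C suc a) ℕ.* (suc a ! ℕ.* k !)) (sym (ℕₚ.m+n∸n≡m (suc a) (suc a)))) (C-factorials (ℕₚ.m≤m+n (suc a) (suc a)))
  regroup₀ : ∀ k c x y → k ℕ.* c ℕ.* (x ℕ.* y) ≡ c ℕ.* (y ℕ.* (k ℕ.* x))
  regroup₀ = ℕ-Solver.solve-∀
  regroup₁ : ∀ k c x y → c ℕ.* (x ℕ.* (k ℕ.* y)) ≡ k ℕ.* c ℕ.* (x ℕ.* y)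
  regroup₁ = ℕ-Solver.solve-∀

-- Rational arithmetic

fromℤ : ℤ → ℚ
fromℤ i = i ℚ./ 1

toℚᵘ-fromℤ : ∀ i → ℚ.toℚᵘ (fromℤ i) ℚᵘ.≃ ℚᵘ.mkℚᵘ i 0
toℚᵘ-fromℤ i = ℚₚ.toℚᵘ-fromℚᵘ (ℚᵘ.mkℚᵘ i 0)

fromℤ-+ : ∀ i j → fromℤ (i + j) ≡ fromℤ i ℚ.+ fromℤ j
fromℤ-+ i j = ℚₚ.toℚᵘ-injective (begin
  ℚ.toℚᵘ (fromℤ (i + j))                      ≈⟨ toℚᵘ-fromℤ (i + j) ⟩
  ℚᵘ.mkℚᵘ (i + j) 0                           ≈⟨ ℚᵘ.*≡* (cong (_* + 1) (cong₂ _+_ (sym (*-identityʳ i)) (sym (*-identityʳ j)))) ⟩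
  ℚᵘ.mkℚᵘ i 0 ℚᵘ.+ ℚᵘ.mkℚᵘ j 0                ≈⟨ ℚᵘₚ.+-cong (toℚᵘ-fromℤ i) (toℚᵘ-fromℤ j) ⟨
  ℚ.toℚᵘ (fromℤ i) ℚᵘ.+ ℚ.toℚᵘ (fromℤ j)      ≈⟨ ℚₚ.toℚᵘ-homo-+ (fromℤ i) (fromℤ j) ⟨
  ℚ.toℚᵘ (fromℤ i ℚ.+ fromℤ j)                ∎)
  where open import Relation.Binary.Reasoning.Setoid ℚᵘₚ.≃-setoid

fromℤ-* : ∀ i j → fromℤ (i * j) ≡ fromℤ i ℚ.* fromℤ j
fromℤ-* i j = ℚₚ.toℚᵘ-injective (begin
  ℚ.toℚᵘ (fromℤ (i * j))                      ≈⟨ toℚᵘ-fromℤ (i * j) ⟩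
  ℚᵘ.mkℚᵘ i 0 ℚᵘ.* ℚᵘ.mkℚᵘ j 0                ≈⟨ ℚᵘₚ.*-cong (toℚᵘ-fromℤ i) (toℚᵘ-fromℤ j) ⟨
  ℚ.toℚᵘ (fromℤ i) ℚᵘ.* ℚ.toℚᵘ (fromℤ j)      ≈⟨ ℚₚ.toℚᵘ-homo-* (fromℤ i) (fromℤ j) ⟨
  ℚ.toℚᵘ (fromℤ i ℚ.* fromℤ j)                ∎)
  where open import Relation.Binary.Reasoning.Setoid ℚᵘₚ.≃-setoid

fromℤ-mono-≤ : ∀ {i j} → i ≤ j → fromℤ i ℚ.≤ fromℤ j
fromℤ-mono-≤ {i} {j} i≤j = ℚₚ.toℚᵘ-cancel-≤ (ℚᵘₚ.≤-trans (ℚᵘₚ.≤-reflexive (toℚᵘ-fromℤ i))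
  (ℚᵘₚ.≤-trans (ℚᵘ.*≤* (*-monoʳ-≤-nonNeg (+ 1) i≤j)) (ℚᵘₚ.≤-reflexive (ℚᵘₚ.≃-sym (toℚᵘ-fromℤ j)))))

natℚ-positive : ∀ {k} → 0 ℕ.< k → ℚ.Positive (natℚ k)
natℚ-positive {suc k} _ = ℚₚ.normalize-pos (suc k) 1

ℚ/-* : ∀ p q → q ≢ 0ℚ → (p ℚ/ q) ℚ.* q ≡ p
ℚ/-* p q q≢0 with q ℚₚ.≟ 0ℚ
... | yes q≡0 = ⊥-elim (q≢0 q≡0)
... | no q≢0′ = trans (ℚₚ.*-assoc p _ q) (trans (cong (p ℚ.*_) (ℚₚ.*-inverseˡ q {{ℚ.≢-nonZero q≢0′}})) (ℚₚ.*-identityʳ p))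

0-ℚ/ : ∀ q → 0ℚ ℚ/ q ≡ 0ℚ
0-ℚ/ q with q ℚₚ.≟ 0ℚ
... | yes _ = refl
... | no q≢0 = ℚₚ.*-zeroˡ ((ℚ.1/ q) {{ℚ.≢-nonZero q≢0}})

sumℚ-pointwise : ∀ {I : Set} (is : List I) {g : I → ℚ} κ (f : I → ℤ) → (∀ i → g i ≡ κ ℚ.* fromℤ (f i)) →
                 sumℚ (map g is) ≡ κ ℚ.* fromℤ (∑ is f)
sumℚ-pointwise []       κ f eq = sym (ℚₚ.*-zeroʳ κ)
sumℚ-pointwise (i ∷ is) κ f eq = trans (cong₂ ℚ._+_ (eq i) (sumℚ-pointwise is κ f eq))
  (trans (sym (ℚₚ.*-distribˡ-+ κ (fromℤ (f i)) (fromℤ (∑ is f)))) (cong (κ ℚ.*_) (sym (fromℤ-+ (f i) (∑ is f)))))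

ℚ-square-nonNeg : ∀ p → ℚ.NonNegative (p ℚ.* p)
ℚ-square-nonNeg p = ℚ.nonNegative (ℚₚ.toℚᵘ-cancel-≤ (ℚᵘₚ.≤-trans (square (ℚ.toℚᵘ p)) (ℚᵘₚ.≤-reflexive (ℚᵘₚ.≃-sym (ℚₚ.toℚᵘ-homo-* p p)))))
  where
  square : ∀ q → ℚᵘ.0ℚᵘ ℚᵘ.≤ q ℚᵘ.* q
  square q@(ℚᵘ.mkℚᵘ i _) = ℚᵘ.*≤* (≤-trans (≤-reflexive (*-zeroˡ (ℚᵘ.↧ (q ℚᵘ.* q))))
    (≤-trans (sq≥0 i) (≤-reflexive (sym (*-identityʳ (i * i))))))

-- The antipodal pairs property of the conditioned measure.

module _ {n} (M : Matroid n) (ρ : Partial n) where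

  open Matroid M using (indep)
  open Minor M ρ

  ν : Measure n
  ν = condition (uniformIndep M) ρ

  mass : ℚ
  mass = (ℚ.1ℚ ℚ/ natℚ (length (filter (λ ζ → indep ζ Bool.≟ true) (allConfigs n)))) ℚ/ condProb (uniformIndep M) ρ

  ν-value : ∀ η → ν η ≡ (if indep η then mass else 0ℚ)
  ν-value η with indep η
  ... | true  = refl
  ... | false = 0-ℚ/ (condProb (uniformIndep M) ρ)

  ν-pair : ∀ η → ν (fill ρ η) ℚ.* ν (flipFree ρ (fill ρ η)) ≡ mass ℚ.* mass ℚ.* fromℤ (indicator (indepPair η))
  ν-pair η = trans (cong₂ ℚ._*_ (ν-value (fill ρ η)) (trans (cong ν (flipFree-fill ρ η)) (ν-value (fill ρ (complement η)))))
    (product (indep (fill ρ η)) (indep (fill ρ (complement η))))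
    where
    product : ∀ x y → (if x then mass else 0ℚ) ℚ.* (if y then mass else 0ℚ) ≡ mass ℚ.* mass ℚ.* fromℤ (indicator (x ∧ y))
    product true  true  = sym (ℚₚ.*-identityʳ (mass ℚ.* mass))
    product true  false = trans (ℚₚ.*-zeroʳ mass) (sym (ℚₚ.*-zeroʳ (mass ℚ.* mass)))
    product false y     = trans (ℚₚ.*-zeroˡ (if y then mass else 0ℚ)) (sym (ℚₚ.*-zeroʳ (mass ℚ.* mass)))

  γ-numerator : ∀ i → sumℚ (map (λ η → ν η ℚ.* ν (flipFree ρ η)) (filter (λ η → freeWeight ρ η ℕₚ.≟ i) (freeConfigs ρ)))
                      ≡ mass ℚ.* mass ℚ.* fromℤ (pairCount i)
  γ-numerator i = trans (cong (sumℚ ∘ map (λ η → ν η ℚ.* ν (flipFree ρ η))) (freeLayer-fill ρ i))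
    (trans (cong sumℚ (sym (map-∘ (layer m i)))) (sumℚ-pointwise (layer m i) (mass ℚ.* mass) (indicator ∘ indepPair) ν-pair))

  γ-* : ∀ i → i ℕ.≤ m → γ ρ ν i ℚ.* natℚ (m C i) ≡ mass ℚ.* mass ℚ.* fromℤ (pairCount i)
  γ-* i i≤m = trans (ℚ/-* _ (natℚ (m C i)) (λ eq → ℚₚ.<⇒≢ (ℚₚ.positive⁻¹ (natℚ (m C i)) {{natℚ-positive (C-positive i≤m)}}) (sym eq))) (γ-numerator i)

  -- Multiplying by both binomial coefficients clears the denominators of the two averages. The
  -- common factor `mass ℚ.* mass` is a square and hence nonnegative, which leaves `counts`:
  -- `pairCount-inequality` rescaled by `central-C`.
  app : ∀ a → m ≡ suc a ℕ.+ suc a → APP ρ ν (suc a)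
  app a m≡ = ℚₚ.*-cancelʳ-≤-pos (c₀ ℚ.* c₁) {{ℚₚ.pos*pos⇒pos c₀ {{c₀>0}} c₁ {{c₁>0}}}} (begin
    γ ρ ν a ℚ.* (c₀ ℚ.* c₁)
      ≡⟨ trans (sym (ℚₚ.*-assoc (γ ρ ν a) c₀ c₁)) (cong (ℚ._* c₁) (γ-* a a≤m)) ⟩
    κ ℚ.* fromℤ n₀ ℚ.* c₁
      ≡⟨ trans (ℚₚ.*-assoc κ (fromℤ n₀) c₁) (cong (κ ℚ.*_) (sym (fromℤ-* n₀ (+ (m C suc a))))) ⟩
    κ ℚ.* fromℤ (n₀ * + (m C suc a))
      ≤⟨ ℚₚ.*-monoˡ-≤-nonNeg κ {{ℚ-square-nonNeg mass}} (fromℤ-mono-≤ counts) ⟩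
    κ ℚ.* fromℤ (n₁ * + (m C a))
      ≡⟨ trans (cong (κ ℚ.*_) (fromℤ-* n₁ (+ (m C a)))) (sym (ℚₚ.*-assoc κ (fromℤ n₁) c₀)) ⟩
    κ ℚ.* fromℤ n₁ ℚ.* c₀
      ≡⟨ trans (cong (ℚ._* c₀) (sym (γ-* (suc a) 1+a≤m))) (trans (ℚₚ.*-assoc (γ ρ ν (suc a)) c₁ c₀) (cong (γ ρ ν (suc a) ℚ.*_) (ℚₚ.*-comm c₁ c₀))) ⟩
    γ ρ ν (suc a) ℚ.* (c₀ ℚ.* c₁) ∎)
    where
    open ℚₚ.≤-Reasoning
    κ c₀ c₁ : ℚ
    κ = mass ℚ.* mass
    c₀ = natℚ (m C a)
    c₁ = natℚ (m C suc a)
    n₀ n₁ : ℤ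
    n₀ = pairCount a
    n₁ = pairCount (suc a)
    1+a≤m : suc a ℕ.≤ m
    1+a≤m = subst (suc a ℕ.≤_) (sym m≡) (ℕₚ.m≤m+n (suc a) (suc a))
    a≤m : a ℕ.≤ m
    a≤m = ℕₚ.≤-trans (ℕₚ.n≤1+n a) 1+a≤m
    c₀>0 : ℚ.Positive c₀
    c₀>0 = natℚ-positive (C-positive a≤m)
    c₁>0 : ℚ.Positive c₁
    c₁>0 = natℚ-positive (C-positive 1+a≤m)
    counts : n₀ * + (m C suc a) ≤ n₁ * + (m C a)
    counts = *-cancelˡ-≤-pos′ {+ suc a} (+<+ (s≤s z≤n)) (≤-trans (≤-reflexive (trans (move (+ suc a) n₀ (+ (m C suc a))) binomial))
      (≤-trans (*-monoʳ-≤-nonNeg (+ (m C a)) (pairCount-inequality a m≡)) (≤-reflexive (*-assoc (+ suc a) n₁ (+ (m C a))))))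
      where
      move : ∀ k n c → k * (n * c) ≡ n * (k * c)
      move = solve-∀
      back : ∀ k n c → n * (k * c) ≡ k * n * c
      back = solve-∀
      binomial : n₀ * (+ suc a * + (m C suc a)) ≡ + suc (suc a) * n₀ * + (m C a)
      binomial = trans (cong (n₀ *_) (trans (sym (pos-* (suc a) (m C suc a))) (trans (cong +_ (sym (central-C m a m≡))) (pos-* (suc (suc a)) (m C a)))))
        (back (+ suc (suc a)) n₀ (+ (m C a)))

theorem1p7 : (n : ℕ) → n ℕ.≤ 11 → (M : Matroid n) → CAPP (uniformIndep M)
theorem1p7 n _ M ρ (suc a) _ m≡ _ = app M ρ a (trans m≡ (cong (suc a ℕ.+_) (ℕₚ.+-identityʳ (suc a))))
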